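{- The online algorithm $\frac12$DistProb is $3$-competitive for online facility location with uniform facility cost in the random-order model; that is, for every input instance $\mathcal{I}=(M,d,U)$, $\mathrm{E}[\mathrm{ALG}(\mathcal{I})]\le 3\cdot \mathrm{OPT}(\mathcal{I})$, where $\mathrm{ALG}(\mathcal{I})$ is the total cost of $\frac12$DistProb on $\mathcal{I}$.
   Context: Facility location: $(M,d)$ is a metric space, $U$ is a (finite, nonempty) multiset of $n$ demand points in $M$ (copies are treated as distinct demands). A facility may be opened at any point of $M$ at cost $1$. For $F\subseteq M$, $d(F,v)=\min_{u\in F}d(u,v)$ and $d(\emptyset,v)=\infty$. The cost of a set of facilities $F\subseteq M$ is $|F|+\sum_{v\in U}d(F,v)$; $\mathrm{OPT}(\mathcal{I})$ is the cost of an optimal (minimum cost) solution, which is taken to exist. Random-order online model: the demands arrive as a uniformly random permutation $v_1,\dots,v_n$ of $U$. When $v_\ell$ arrives the algorithm immediately and irrevocably decides whether and where to open new facilities, and then $v_\ell$ is irrevocably assigned to its nearest open facility. With $F_\ell$ the set of facilities opened by the end of round $\ell$ ($F_0=\emptyset$), the total cost is $|F_n|+\sum_{\ell=1}^n d(F_\ell,v_\ell)$. Expectations are over the arrival order and the coin flips of the algorithm. $\frac12$DistProb: when $v_\ell$ arrives, with probability $\min\{\frac12 d(F_{\ell-1},v_\ell),1\}$ (fresh independent coin) set $F_\ell=F_{\ell-1}\cup\{v_\ell\}$ (paying $1$ for opening a facility at $v_\ell$), otherwise set $F_\ell=F_{\ell-1}$; assign $v_\ell$ to its nearest facility in $F_\ell$.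 -}

module Defs where

open import Level using (Level; _⊔_; suc)
open import Data.Nat.Base as ℕ using (ℕ)
open import Data.Bool.Base using (Bool; true; false; if_then_else_)
open import Data.List.Base as List
  using (List; []; _∷_; [_]; map; concatMap; foldr; length; allFin; deduplicate)
open import Data.Product.Base as Product using (_,_)
open import Data.Vec.Base as Vec using (Vec; []; _∷_; lookup; removeAt)
open import Algebra.Core using (Op₁; Op₂)
open import Algebra.Structures using (IsCommutativeRing)
open import Algebra.Bundles using (CommutativeRing)
open import Function.Metric.Structures using (IsGeneralMetric)
open import Relation.Binary.Core using (Rel)
open import Relation.Binary.Bundles using (DecTotalOrder)
open import Relation.Binary.Definitions using (Decidable)
open import Relation.Binary.Structures using (IsDecTotalOrder)
open import Relation.Nullary.Decidable.Core using (does; map′)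
open import Relation.Nullary.Negation.Core using (¬_)
open import Relation.Nullary.Construct.Add.Supremum as Add⁺ using (_⁺; ⊤⁺)
import Algebra.Construct.NaturalChoice.Min as Min
import Algebra.Definitions.RawMonoid as RawMonoidDefs
import Relation.Binary.Construct.Add.Supremum.NonStrict as Supremum

-- The standard library has no real numbers, so the scalars are an arbitrary
-- linearly ordered field; classically ℝ is an instance, as is ℚ.
-- Inversion is total, with an unspecified value at 0#.

record OrderedField c ℓ₁ ℓ₂ : Set (suc (c ⊔ ℓ₁ ⊔ ℓ₂)) where
  infix  4 _≈_ _≤_
  infixl 6 _+_
  infixl 7 _*_
  infix  8 -_ _⁻¹
  field
    Carrier           : Set c
    _≈_               : Rel Carrier ℓ₁
    _≤_               : Rel Carrier ℓ₂
    _+_ _*_           : Op₂ Carrier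
    -_ _⁻¹            : Op₁ Carrier
    0# 1#             : Carrier
    isCommutativeRing : IsCommutativeRing _≈_ _+_ _*_ -_ 0# 1#
    isDecTotalOrder   : IsDecTotalOrder _≈_ _≤_
    +-monoˡ-≤         : ∀ {x y} z → x ≤ y → x + z ≤ y + z
    *-nonNegative     : ∀ {x y} → 0# ≤ x → 0# ≤ y → 0# ≤ x * y
    0≉1               : ¬ (0# ≈ 1#)
    ⁻¹-inverseʳ       : ∀ {x} → ¬ (x ≈ 0#) → x * x ⁻¹ ≈ 1#

  commutativeRing : CommutativeRing c ℓ₁
  commutativeRing = record { isCommutativeRing = isCommutativeRing }

  decTotalOrder : DecTotalOrder c ℓ₁ ℓ₂
  decTotalOrder = record { isDecTotalOrder = isDecTotalOrder }

  open IsDecTotalOrder isDecTotalOrder public using (_≟_; _≤?_)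
  open Min (DecTotalOrder.totalOrder decTotalOrder) public using (_⊓_)

  fromℕ : ℕ → Carrier
  fromℕ n = n × 1#
    where open RawMonoidDefs (CommutativeRing.+-rawMonoid commutativeRing) using (_×_)

  ½ : Carrier
  ½ = fromℕ 2 ⁻¹

record MetricSpace {c ℓ₁ ℓ₂} (R : OrderedField c ℓ₁ ℓ₂) a ℓ
                 : Set (c ⊔ ℓ₁ ⊔ ℓ₂ ⊔ suc (a ⊔ ℓ)) where
  private module R = OrderedField R
  infix 4 _≈ₘ_
  field
    Point    : Set a
    _≈ₘ_     : Rel Point ℓ
    d        : Point → Point → R.Carrier
    isMetric : IsGeneralMetric _≈ₘ_ R._≈_ R._≤_ R.0# R._+_ d

  _≟ₘ_ : Decidable _≈ₘ_
  x ≟ₘ y = map′ 0⇒≈ ≈⇒0 (d x y R.≟ R.0#)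
    where open IsGeneralMetric isMetric

-- All n ! orders of the n entries of a vector. Entries are told apart by their
-- position, so equal entries count as distinct.

permutations : ∀ {a} {A : Set a} {n} → Vec A n → List (Vec A n)
permutations {n = ℕ.zero}  []  = [ [] ]
permutations {n = ℕ.suc n} xs =
  concatMap (λ i → map (lookup xs i ∷_) (permutations (removeAt xs i)))
            (allFin (ℕ.suc n))

module Extended {c ℓ₁ ℓ₂} (R : OrderedField c ℓ₁ ℓ₂) where
  open OrderedField R
  open Supremum _≤_ public using (_≤⁺_)

  infixl 6 _+⁺_
  infixr 7 _·_

  fin : Carrier → Carrier ⁺
  fin = Add⁺.[_]

  ∞ : Carrier ⁺
  ∞ = ⊤⁺

  _+⁺_ : Op₂ (Carrier ⁺)
  Add⁺.[ x ] +⁺ Add⁺.[ y ] = fin (x + y)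
  Add⁺.[ x ] +⁺ ⊤⁺         = ∞
  ⊤⁺         +⁺ y          = ∞

  _⊓⁺_ : Op₂ (Carrier ⁺)
  Add⁺.[ x ] ⊓⁺ Add⁺.[ y ] = fin (x ⊓ y)
  Add⁺.[ x ] ⊓⁺ ⊤⁺         = fin x
  ⊤⁺         ⊓⁺ y          = y

  -- Scaling by a nonnegative scalar, with 0 · ∞ = 0, so that an infinite cost
  -- on an event of probability zero does not contribute to an expectation.
  _·_ : Carrier → Carrier ⁺ → Carrier ⁺
  p · Add⁺.[ x ] = fin (p * x)
  p · ⊤⁺         = if does (p ≟ 0#) then fin 0# else ∞

-- Finitely supported probability distributions, as lists of weighted outcomes.

module Probability {c ℓ₁ ℓ₂} (R : OrderedField c ℓ₁ ℓ₂) where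
  open OrderedField R
  open Extended R

  private variable
    a b : Level
    A : Set a
    B : Set b

  Dist : Set a → Set (c ⊔ a)
  Dist A = List (Carrier Product.× A)

  pure : A → Dist A
  pure x = [ 1# , x ]

  infixl 1 _>>=_
  _>>=_ : Dist A → (A → Dist B) → Dist B
  D >>= f = concatMap (λ { (p , x) → map (λ { (q , y) → p * q , y }) (f x) }) D

  bernoulli : Carrier → Dist Bool
  bernoulli p = (p , true) ∷ (1# + - p , false) ∷ []

  uniform : List A → Dist A
  uniform xs = map (fromℕ (length xs) ⁻¹ ,_) xs

  E : Dist (Carrier ⁺) → Carrier ⁺
  E = foldr (λ { (p , x) s → p · x +⁺ s }) (fin 0#)

module FacilityLocation {c ℓ₁ ℓ₂ a ℓ} (R : OrderedField c ℓ₁ ℓ₂)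
                        (M : MetricSpace R a ℓ) where
  open OrderedField R
  open MetricSpace M public
  open Extended R public
  open Probability R public

  -- A list stands for the finite set of its members, so ∣ F ∣ discounts
  -- repetitions. Infinite sets of facilities have infinite cost and are omitted.
  Facilities : Set a
  Facilities = List Point

  ∣_∣ : Facilities → Carrier
  ∣ F ∣ = fromℕ (length (deduplicate _≟ₘ_ F))

  dist : Facilities → Point → Carrier ⁺
  dist F v = foldr (λ u m → fin (d u v) ⊓⁺ m) ∞ F

  cost : ∀ {n} → Vec Point n → Facilities → Carrier ⁺
  cost U F = fin ∣ F ∣ +⁺ Vec.foldr′ (λ v s → dist F v +⁺ s) (fin 0#) U

  IsOptimal : ∀ {n} → Vec Point n → Facilities → Set (c ⊔ ℓ₂ ⊔ a)
  IsOptimal U F = ∀ G → cost U F ≤⁺ cost U G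

  -- min{½ · x , 1}
  openProb : Carrier ⁺ → Carrier
  openProb Add⁺.[ x ] = (½ * x) ⊓ 1#
  openProb ⊤⁺         = 1#

  ½DistProb : Facilities → Point → Dist Facilities
  ½DistProb F v =
    bernoulli (openProb (dist F v)) >>= λ opened →
    pure (if opened then v ∷ F else F)

  -- From the open facilities F and the demands still to come, the assignment
  -- costs of the remaining rounds plus the number of facilities open at the end.
  run : ∀ {n} → (Facilities → Point → Dist Facilities) →
        Facilities → Vec Point n → Dist (Carrier ⁺)
  run step F []       = pure (fin ∣ F ∣)
  run step F (v ∷ vs) =
    step F v       >>= λ F′ →
    run step F′ vs >>= λ x  →
    pure (dist F′ v +⁺ x)

  ALG : ∀ {n} → Vec Point n → Dist (Carrier ⁺)
  ALG U = uniform (permutations U) >>= run ½DistProb []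

{-# OPTIONS --safe #-}

-- Let P(F,v) = min{½ d(F,v), 1} be the probability of opening a facility at v.
-- A demand costs at most 3 P(F,v) in expectation when it arrives, so ALG is at
-- most three times the expected number of openings, and it suffices that the
-- demands of an optimal cluster with centre c open at most 1 + Σ d(c,v)
-- facilities in expectation, whatever the other demands do. With s(v) = ½ d(c,v)
-- and δ = P(F,c), the potential
--     Σ 2 s(v) + min{1, Σ (δ − s(v))}     (sums over the remaining demands of the cluster)
-- dominates the expected number of openings still to come from the cluster: each
-- demand pays 2 s(v) on arrival, while P(F,v) ≤ δ + s(v), and on average over the
-- next demand an opening at v, which lowers δ to at most s(v), pays for itself.

module Submission where

open import Algebra.Bundles using (CommutativeRing)
open import Algebra.Solver.Ring.AlmostCommutativeRing
  using (fromCommutativeRing; _-Raw-AlmostCommutative⟶_)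
import Algebra.Construct.NaturalChoice.Min as Min
import Algebra.Properties.Ring as RingProperties
import Algebra.Properties.Semiring.Mult as Multiples
import Algebra.Properties.Semiring.Mult.TCOptimised as OptimisedMultiples
import Algebra.Solver.Ring as RingSolver
open import Data.Bool.Base using (Bool; true; false; if_then_else_)
open import Data.Fin.Base using (Fin; zero; suc)
import Data.Fin.Properties as Fin
open import Data.Integer.Base as ℤ using (ℤ; +_; -[1+_])
import Data.Integer.Properties as ℤ
open import Data.List.Base as List
  using (List; []; _∷_; _++_; map; concatMap; foldr; length; allFin; tabulate; deduplicate)
open import Data.List.Properties using (map-tabulate; length-tabulate; length-filter)
open import Data.List.Relation.Unary.All as All using (All; []; _∷_)
import Data.List.Relation.Unary.All.Properties as All
open import Data.List.Relation.Unary.Any as Any using (Any; here; there)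
import Data.List.Relation.Unary.Any.Properties as Any
import Data.Maybe.Base as Maybe
open import Data.Nat.Base as ℕ using (ℕ; suc; _!)
import Data.Nat.Properties as ℕ
open import Data.Product.Base as Product using (Σ-syntax; ∃-syntax; _,_; proj₁; proj₂)
open import Data.Sum.Base using (_⊎_; inj₁; inj₂)
open import Data.Vec.Base as Vec using (Vec; []; _∷_; lookup; removeAt; toList)
open import Function.Base using (_∘_; id)
open import Function.Metric.Structures using (IsGeneralMetric)
open import Level using (Level)
open import Relation.Binary.Bundles using (DecTotalOrder)
open import Relation.Binary.Consequences using (dec⇒weaklyDec)
open import Relation.Binary.Construct.Add.Supremum.NonStrict using ([_]; _≤⊤⁺)
open import Relation.Binary.Definitions using (WeaklyDecidable)
import Relation.Binary.PropositionalEquality.Core as ≡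
open ≡ using (_≡_)
import Relation.Binary.Reasoning.PartialOrder as PartialOrderReasoning
import Relation.Binary.Reasoning.Setoid as SetoidReasoning
open import Relation.Nullary.Construct.Add.Supremum as Add⁺ using (_⁺; ⊤⁺)
open import Relation.Nullary.Decidable.Core using (does; yes; no)
open import Relation.Nullary.Negation.Core using (¬_; contradiction)
open import Defs

private variable
  a b : Level
  A : Set a
  B : Set b
  n : ℕ

-- Integer coefficients for the ring solver

module IntegerCoefficients {c ℓ} (A : CommutativeRing c ℓ) where
  open CommutativeRing A
  open RingProperties ring using (-0#≈0#; -‿involutive; -‿distribˡ-*; -‿distribʳ-*; -‿+-comm)
  open OptimisedMultiples semiring using (_×_; 1+×; ×-homo-+; ×1-homo-*)
  open SetoidReasoning setoid

  -- The optimised multiple makes `⟦ + 0 ⟧` and `⟦ + 1 ⟧` reduce to `0#` and `1#`, so solver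
  -- equations match goals containing these constants by definition.
  ⟦_⟧ : ℤ → Carrier
  ⟦ + n ⟧      = n × 1#
  ⟦ -[1+ n ] ⟧ = - (suc n × 1#)

  -‿homo : ∀ i → ⟦ ℤ.- i ⟧ ≈ - ⟦ i ⟧
  -‿homo (+ 0)     = sym -0#≈0#
  -‿homo (+ suc n) = refl
  -‿homo -[1+ n ]  = sym (-‿involutive _)

  ⊖-homo : ∀ m n → ⟦ m ℤ.⊖ n ⟧ ≈ m × 1# + - (n × 1#)
  ⊖-homo m       0       = sym (trans (+-congˡ -0#≈0#) (+-identityʳ _))
  ⊖-homo 0       (suc n) = sym (+-identityˡ _)
  ⊖-homo (suc m) (suc n) = begin
    ⟦ suc m ℤ.⊖ suc n ⟧                     ≡⟨ ≡.cong ⟦_⟧ (ℤ.[1+m]⊖[1+n]≡m⊖n m n) ⟩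
    ⟦ m ℤ.⊖ n ⟧                             ≈⟨ ⊖-homo m n ⟩
    m × 1# + - (n × 1#)                     ≈⟨ +-congʳ (+-identityʳ _) ⟨
    m × 1# + 0# + - (n × 1#)                ≈⟨ +-congʳ (+-congˡ (-‿inverseʳ 1#)) ⟨
    m × 1# + (1# + - 1#) + - (n × 1#)       ≈⟨ +-congʳ (+-assoc _ _ _) ⟨
    (m × 1# + 1#) + - 1# + - (n × 1#)       ≈⟨ +-assoc _ _ _ ⟩
    (m × 1# + 1#) + (- 1# + - (n × 1#))     ≈⟨ +-cong (+-comm _ _) (-‿+-comm _ _) ⟩
    (1# + m × 1#) + - (1# + n × 1#)         ≈⟨ +-cong (1+× m 1#) (-‿cong (1+× n 1#)) ⟨
    suc m × 1# + - (suc n × 1#)             ∎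

  +-homo : ∀ i j → ⟦ i ℤ.+ j ⟧ ≈ ⟦ i ⟧ + ⟦ j ⟧
  +-homo (+ m)    (+ n)    = ×-homo-+ 1# m n
  +-homo (+ m)    -[1+ n ] = ⊖-homo m (suc n)
  +-homo -[1+ m ] (+ n)    = trans (⊖-homo n (suc m)) (+-comm _ _)
  +-homo -[1+ m ] -[1+ n ] = begin
    - (suc (suc (m ℕ.+ n)) × 1#)            ≡⟨ ≡.cong (λ k → ⟦ ℤ.- (+ k) ⟧) (ℕ.+-suc (suc m) n) ⟨
    - ((suc m ℕ.+ suc n) × 1#)              ≈⟨ -‿cong (×-homo-+ 1# (suc m) (suc n)) ⟩
    - (suc m × 1# + suc n × 1#)             ≈⟨ -‿+-comm _ _ ⟨
    - (suc m × 1#) + - (suc n × 1#)         ∎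

  pos-*-homo : ∀ m j → ⟦ + m ℤ.* j ⟧ ≈ ⟦ + m ⟧ * ⟦ j ⟧
  pos-*-homo m (+ n) = begin
    ⟦ + m ℤ.* + n ⟧            ≡⟨ ≡.cong ⟦_⟧ (ℤ.pos-* m n) ⟨
    (m ℕ.* n) × 1#             ≈⟨ ×1-homo-* m n ⟩
    m × 1# * n × 1#            ∎
  pos-*-homo m -[1+ n ] = begin
    ⟦ + m ℤ.* -[1+ n ] ⟧       ≡⟨ ≡.cong ⟦_⟧ (ℤ.neg-distribʳ-* (+ m) (+ suc n)) ⟨
    ⟦ ℤ.- (+ m ℤ.* + suc n) ⟧  ≈⟨ -‿homo (+ m ℤ.* + suc n) ⟩
    - ⟦ + m ℤ.* + suc n ⟧      ≈⟨ -‿cong (pos-*-homo m (+ suc n)) ⟩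
    - (m × 1# * suc n × 1#)    ≈⟨ -‿distribʳ-* _ _ ⟩
    m × 1# * - (suc n × 1#)    ∎

  *-homo : ∀ i j → ⟦ i ℤ.* j ⟧ ≈ ⟦ i ⟧ * ⟦ j ⟧
  *-homo (+ m)    j = pos-*-homo m j
  *-homo -[1+ m ] j = begin
    ⟦ -[1+ m ] ℤ.* j ⟧         ≡⟨ ≡.cong ⟦_⟧ (ℤ.neg-distribˡ-* (+ suc m) j) ⟨
    ⟦ ℤ.- (+ suc m ℤ.* j) ⟧    ≈⟨ -‿homo (+ suc m ℤ.* j) ⟩
    - ⟦ + suc m ℤ.* j ⟧        ≈⟨ -‿cong (pos-*-homo (suc m) j) ⟩
    - (suc m × 1# * ⟦ j ⟧)     ≈⟨ -‿distribˡ-* _ _ ⟩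
    - (suc m × 1#) * ⟦ j ⟧     ∎

  morphism : ℤ.+-*-rawRing -Raw-AlmostCommutative⟶ fromCommutativeRing A
  morphism = record
    { ⟦_⟧    = ⟦_⟧
    ; +-homo = +-homo
    ; *-homo = *-homo
    ; -‿homo = -‿homo
    ; 0-homo = refl
    ; 1-homo = refl
    }

  ⟦⟧-weaklyDecidable : WeaklyDecidable (λ i j → ⟦ i ⟧ ≈ ⟦ j ⟧)
  ⟦⟧-weaklyDecidable i j = Maybe.map (λ i≡j → reflexive (≡.cong ⟦_⟧ i≡j)) (dec⇒weaklyDec ℤ._≟_ i j)

-- Arithmetic in a linearly ordered field

module OrderedFieldProperties {c ℓ₁ ℓ₂} (R : OrderedField c ℓ₁ ℓ₂) where
  open OrderedField R
  open CommutativeRing commutativeRing public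
    using ( refl; sym; trans; reflexive; setoid; +-cong; +-congˡ; +-congʳ; *-cong; *-congˡ; *-congʳ
          ; +-identityˡ; +-identityʳ; *-identityˡ; *-identityʳ; -‿cong; zeroˡ; zeroʳ; -‿inverseʳ
          ; +-comm; *-comm; +-assoc; *-assoc; distribˡ; distribʳ; semiring)
  open DecTotalOrder decTotalOrder public
    using (total; ≤-respʳ-≈; ≤-respˡ-≈)
    renaming (refl to ≤-refl; reflexive to ≤-reflexive; trans to ≤-trans; antisym to ≤-antisym)
  open Min (DecTotalOrder.totalOrder decTotalOrder) public
    using (x⊓y≤x; x⊓y≤y; ⊓-glb; ⊓-sel; ⊓-mono-≤)
  module ≤-Reasoning = PartialOrderReasoning (DecTotalOrder.poset decTotalOrder)
  module ℤ-Solver = RingSolver ℤ.+-*-rawRing (fromCommutativeRing commutativeRing)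
    (IntegerCoefficients.morphism commutativeRing)
    (IntegerCoefficients.⟦⟧-weaklyDecidable commutativeRing)
  open ℤ-Solver using (solve; _:=_; con; _:+_; _:*_; _:-_)

  -- The certificate method for polynomial inequalities: `e` is assembled from sums and products of
  -- nonnegative terms, and the identity `y + - x ≈ e` is left to the ring solver.
  ≤-by : ∀ {x y e} → 0# ≤ e → y + - x ≈ e → x ≤ y
  ≤-by {x} {y} {e} 0≤e y-x≈e = begin
    x              ≈⟨ +-identityˡ x ⟨
    0# + x         ≤⟨ +-monoˡ-≤ x 0≤e ⟩
    e + x          ≈⟨ +-congʳ y-x≈e ⟨
    y + - x + x    ≈⟨ solve 2 (λ x y → y :- x :+ x := y) refl x y ⟩
    y              ∎
    where open ≤-Reasoning

  0≤y-x : ∀ {x y} → x ≤ y → 0# ≤ y + - x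
  0≤y-x {x} x≤y = ≤-respˡ-≈ (-‿inverseʳ x) (+-monoˡ-≤ (- x) x≤y)

  +-mono-≤ : ∀ {x y u v} → x ≤ y → u ≤ v → x + u ≤ y + v
  +-mono-≤ {x} {y} {u} {v} x≤y u≤v = begin
    x + u  ≤⟨ +-monoˡ-≤ u x≤y ⟩
    y + u  ≈⟨ +-comm y u ⟩
    u + y  ≤⟨ +-monoˡ-≤ y u≤v ⟩
    v + y  ≈⟨ +-comm v y ⟩
    y + v  ∎
    where open ≤-Reasoning

  +-monoʳ-≤ : ∀ x {y z} → y ≤ z → x + y ≤ x + z
  +-monoʳ-≤ x = +-mono-≤ ≤-refl

  +-nonNegative : ∀ {x y} → 0# ≤ x → 0# ≤ y → 0# ≤ x + y
  +-nonNegative 0≤x 0≤y = ≤-respˡ-≈ (+-identityˡ 0#) (+-mono-≤ 0≤x 0≤y)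

  *-monoˡ-≤ : ∀ {p x y} → 0# ≤ p → x ≤ y → p * x ≤ p * y
  *-monoˡ-≤ {p} {x} {y} 0≤p x≤y = ≤-by (*-nonNegative 0≤p (0≤y-x x≤y))
    (solve 3 (λ p x y → p :* y :- p :* x := p :* (y :- x)) refl p x y)

  0≤1 : 0# ≤ 1#
  0≤1 with total 0# 1#
  ... | inj₁ 0≤1 = 0≤1
  -- If `1#` were at most `0#`, then `0# + - 1#` would be nonnegative, and hence so would its
  -- square, which is `1#`.
  ... | inj₂ 1≤0 = ≤-respʳ-≈ (solve 0 ((con (+ 0) :- con (+ 1)) :* (con (+ 0) :- con (+ 1)) := con (+ 1)) refl)
                     (*-nonNegative (0≤y-x 1≤0) (0≤y-x 1≤0))

  0≤fromℕ : ∀ n → 0# ≤ fromℕ n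
  0≤fromℕ 0       = ≤-refl
  0≤fromℕ (suc n) = +-nonNegative 0≤1 (0≤fromℕ n)

  fromℕ-mono-≤ : ∀ {m n} → m ℕ.≤ n → fromℕ m ≤ fromℕ n
  fromℕ-mono-≤ {n = n} ℕ.z≤n = 0≤fromℕ n
  fromℕ-mono-≤ (ℕ.s≤s m≤n)   = +-monoʳ-≤ 1# (fromℕ-mono-≤ m≤n)

  fromℕ[1+n]≉0 : ∀ n → ¬ (fromℕ (suc n) ≈ 0#)
  fromℕ[1+n]≉0 n 1+n≈0 = 0≉1 (≤-antisym 0≤1 (≤-respʳ-≈ 1+n≈0 (≤-respˡ-≈ (+-identityʳ 1#) (+-monoʳ-≤ 1# (0≤fromℕ n)))))

  ½x+½x≈x : ∀ x → ½ * x + ½ * x ≈ x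
  ½x+½x≈x x = begin
    ½ * x + ½ * x              ≈⟨ solve 2 (λ h x → h :* x :+ h :* x := (con (+ 1) :+ (con (+ 1) :+ con (+ 0))) :* h :* x) refl ½ x ⟩
    fromℕ 2 * ½ * x            ≈⟨ *-congʳ (⁻¹-inverseʳ (fromℕ[1+n]≉0 1)) ⟩
    1# * x                     ≈⟨ *-identityˡ x ⟩
    x                          ∎
    where open SetoidReasoning setoid

  -- If `½ * x` is at most zero, then `x`, being twice `½ * x`, is at most `½ * x`. The sign of `½`
  -- itself is not presupposed; it is the case `x = 1#`.
  ½-nonNegative : ∀ {x} → 0# ≤ x → 0# ≤ ½ * x
  ½-nonNegative {x} 0≤x with total 0# (½ * x)
  ... | inj₁ 0≤½x = 0≤½x
  ... | inj₂ ½x≤0 = ≤-trans 0≤x (begin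
    x              ≈⟨ ½x+½x≈x x ⟨
    ½ * x + ½ * x  ≤⟨ +-monoʳ-≤ (½ * x) ½x≤0 ⟩
    ½ * x + 0#     ≈⟨ +-identityʳ _ ⟩
    ½ * x          ∎)
    where open ≤-Reasoning

  0≤½ : 0# ≤ ½
  0≤½ = ≤-respʳ-≈ (*-identityʳ ½) (½-nonNegative 0≤1)

  ⁻¹-nonNegative : ∀ {x} → 0# ≤ x → ¬ (x ≈ 0#) → 0# ≤ x ⁻¹
  ⁻¹-nonNegative {x} 0≤x x≉0 with total 0# (x ⁻¹)
  ... | inj₁ 0≤x⁻¹ = 0≤x⁻¹
  ... | inj₂ x⁻¹≤0 = contradiction (≤-antisym 0≤1 (begin
    1#        ≈⟨ ⁻¹-inverseʳ x≉0 ⟨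
    x * x ⁻¹  ≤⟨ *-monoˡ-≤ 0≤x x⁻¹≤0 ⟩
    x * 0#    ≈⟨ zeroʳ x ⟩
    0#        ∎)) 0≉1
    where open ≤-Reasoning

-- Finite sums over lists, positions and permutations

module ListSum {c ℓ₁ ℓ₂} (R : OrderedField c ℓ₁ ℓ₂) where
  open OrderedField R
  open OrderedFieldProperties R
  open ℤ-Solver using (solve; _:=_; con; _:+_; _:*_)

  ∑ : List A → (A → Carrier) → Carrier
  ∑ xs f = foldr (λ x s → f x + s) 0# xs

  indicator : Bool → Carrier
  indicator b = if b then 1# else 0#

  0≤indicator : ∀ b → 0# ≤ indicator b
  0≤indicator true  = 0≤1
  0≤indicator false = ≤-refl

  ∑-cong : ∀ (xs : List A) {f g : A → Carrier} → (∀ x → f x ≈ g x) → ∑ xs f ≈ ∑ xs g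
  ∑-cong []       f≈g = refl
  ∑-cong (x ∷ xs) f≈g = +-cong (f≈g x) (∑-cong xs f≈g)

  ∑-mono-≤ : ∀ (xs : List A) {f g : A → Carrier} → (∀ x → f x ≤ g x) → ∑ xs f ≤ ∑ xs g
  ∑-mono-≤ []       f≤g = ≤-refl
  ∑-mono-≤ (x ∷ xs) f≤g = +-mono-≤ (f≤g x) (∑-mono-≤ xs f≤g)

  ∑-+ : ∀ (xs : List A) (f g : A → Carrier) → ∑ xs (λ x → f x + g x) ≈ ∑ xs f + ∑ xs g
  ∑-+ []       f g = sym (+-identityˡ 0#)
  ∑-+ (x ∷ xs) f g = trans (+-congˡ (∑-+ xs f g))
    (solve 4 (λ a b c d → (a :+ b) :+ (c :+ d) := (a :+ c) :+ (b :+ d)) refl _ _ _ _)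

  ∑-*ˡ : ∀ (xs : List A) p (f : A → Carrier) → ∑ xs (λ x → p * f x) ≈ p * ∑ xs f
  ∑-*ˡ []       p f = sym (zeroʳ p)
  ∑-*ˡ (x ∷ xs) p f = trans (+-congˡ (∑-*ˡ xs p f)) (sym (distribˡ p _ _))

  ∑-const : ∀ (xs : List A) p → ∑ xs (λ _ → p) ≈ fromℕ (length xs) * p
  ∑-const []       p = sym (zeroˡ p)
  ∑-const (x ∷ xs) p = trans (+-cong (sym (*-identityˡ p)) (∑-const xs p)) (sym (distribʳ p _ _))

  ∑-zero : ∀ (xs : List A) → ∑ xs (λ _ → 0#) ≈ 0#
  ∑-zero xs = trans (∑-const xs 0#) (zeroʳ _)

  ∑-nonNegative : ∀ (xs : List A) {f : A → Carrier} → (∀ x → 0# ≤ f x) → 0# ≤ ∑ xs f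
  ∑-nonNegative xs 0≤f = ≤-respˡ-≈ (∑-zero xs) (∑-mono-≤ xs 0≤f)

  ∑-comm : ∀ (xs : List A) (ys : List B) (f : A → B → Carrier) →
           ∑ xs (λ x → ∑ ys (f x)) ≈ ∑ ys (λ y → ∑ xs (λ x → f x y))
  ∑-comm []       ys f = sym (∑-zero ys)
  ∑-comm (x ∷ xs) ys f = trans (+-congˡ (∑-comm xs ys f)) (sym (∑-+ ys (f x) _))

  ∑-map : ∀ (h : A → B) xs (f : B → Carrier) → ∑ (map h xs) f ≡ ∑ xs (f ∘ h)
  ∑-map h []       f = ≡.refl
  ∑-map h (x ∷ xs) f = ≡.cong (λ s → f (h x) + s) (∑-map h xs f)

  ∑-++ : ∀ (xs ys : List A) (f : A → Carrier) → ∑ (xs ++ ys) f ≈ ∑ xs f + ∑ ys f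
  ∑-++ []       ys f = sym (+-identityˡ _)
  ∑-++ (x ∷ xs) ys f = trans (+-congˡ (∑-++ xs ys f)) (sym (+-assoc _ _ _))

  ∑-concatMap : ∀ (g : A → List B) xs (f : B → Carrier) → ∑ (concatMap g xs) f ≈ ∑ xs (λ x → ∑ (g x) f)
  ∑-concatMap g []       f = refl
  ∑-concatMap g (x ∷ xs) f = trans (∑-++ (g x) _ f) (+-congˡ (∑-concatMap g xs f))

  ∑-tabulate : ∀ (h : Fin n → A) (f : A → Carrier) → ∑ (tabulate h) f ≡ ∑ (allFin n) (f ∘ h)
  ∑-tabulate h f = ≡.trans (≡.cong (λ xs → ∑ xs f) (≡.sym (map-tabulate id h))) (∑-map h (allFin _) f)

  ∑-allFin-suc : ∀ (f : Fin (suc n) → Carrier) → ∑ (allFin (suc n)) f ≡ f zero + ∑ (allFin n) (f ∘ suc)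
  ∑-allFin-suc f = ≡.cong (λ s → f zero + s) (∑-tabulate suc f)

  ∑-allFin-const : ∀ n p → ∑ (allFin n) (λ _ → p) ≈ fromℕ n * p
  ∑-allFin-const n p = trans (∑-const (allFin n) p)
    (*-congʳ (reflexive (≡.cong fromℕ (length-tabulate (id {A = Fin n})))))

  ∑-lookup : ∀ (xs : Vec A n) (f : A → Carrier) → ∑ (allFin n) (f ∘ lookup xs) ≈ ∑ (toList xs) f
  ∑-lookup []       f = refl
  ∑-lookup (x ∷ xs) f = trans (reflexive (∑-allFin-suc (f ∘ lookup (x ∷ xs)))) (+-congˡ (∑-lookup xs f))

  ∑-removeAt : ∀ (xs : Vec A (suc n)) i (f : A → Carrier) →
               ∑ (toList xs) f ≈ f (lookup xs i) + ∑ (toList (removeAt xs i)) f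
  ∑-removeAt (x ∷ xs)     zero    f = refl
  ∑-removeAt (x ∷ y ∷ xs) (suc i) f = trans (+-congˡ (∑-removeAt (y ∷ xs) i f))
    (solve 3 (λ a b c → a :+ (b :+ c) := b :+ (a :+ c)) refl _ _ _)

  -- Applied to the index of the nearest centre, this collapses a sum over clusters to the one
  -- cluster containing a given demand.
  ∑-δ : ∀ (i : Fin n) (f : Fin n → Carrier) → ∑ (allFin n) (λ j → indicator (does (i Fin.≟ j)) * f j) ≈ f i
  ∑-δ {suc n} zero f = begin
    ∑ (allFin (suc n)) (λ j → indicator (does (zero Fin.≟ j)) * f j)  ≡⟨ ∑-allFin-suc (λ j → indicator (does (zero Fin.≟ j)) * f j) ⟩
    1# * f zero + ∑ (allFin n) (λ j → 0# * f (suc j))                 ≈⟨ +-cong (*-identityˡ _) (∑-*ˡ (allFin n) 0# (f ∘ suc)) ⟩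
    f zero + 0# * ∑ (allFin n) (f ∘ suc)                              ≈⟨ solve 2 (λ a b → a :+ con (+ 0) :* b := a) refl _ _ ⟩
    f zero                                                            ∎
    where open SetoidReasoning setoid
  ∑-δ {suc n} (suc i) f = begin
    ∑ (allFin (suc n)) (λ j → indicator (does (suc i Fin.≟ j)) * f j)  ≡⟨ ∑-allFin-suc (λ j → indicator (does (suc i Fin.≟ j)) * f j) ⟩
    0# * f zero + ∑ (allFin n) (λ j → indicator (does (i Fin.≟ j)) * f (suc j))
                                                                      ≈⟨ +-cong (zeroˡ _) (∑-δ i (f ∘ suc)) ⟩
    0# + f (suc i)                                                    ≈⟨ +-identityˡ _ ⟩
    f (suc i)                                                         ∎
    where open SetoidReasoning setoid

  -- Conditioning on the first arrival: a uniformly random order is a uniformly random first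
  -- position followed by a uniformly random order of the rest.
  ∑-permutations : ∀ (xs : Vec A (suc n)) (f : Vec A (suc n) → Carrier) →
    ∑ (permutations xs) f ≈ ∑ (allFin (suc n)) (λ i → ∑ (permutations (removeAt xs i)) (λ ys → f (lookup xs i ∷ ys)))
  ∑-permutations {n = n} xs f = trans (∑-concatMap (λ i → map (lookup xs i ∷_) (permutations (removeAt xs i))) (allFin (suc n)) f)
    (∑-cong (allFin (suc n)) (λ i → reflexive (∑-map (lookup xs i ∷_) (permutations (removeAt xs i)) f)))

  -- With `p = 1#` this counts the orders inside the field, so that the length of `permutations xs`
  -- need not be computed in the natural numbers.
  ∑-permutations-const : ∀ (xs : Vec A n) p → ∑ (permutations xs) (λ _ → p) ≈ fromℕ (n !) * p
  ∑-permutations-const []             p = trans (+-identityʳ p) (solve 1 (λ p → p := (con (+ 1) :+ con (+ 0)) :* p) refl p)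
  ∑-permutations-const {n = suc n} xs p = begin
    ∑ (permutations xs) (λ _ → p)                                            ≈⟨ ∑-permutations xs (λ _ → p) ⟩
    ∑ (allFin (suc n)) (λ i → ∑ (permutations (removeAt xs i)) (λ _ → p))    ≈⟨ ∑-cong (allFin (suc n)) (λ i → ∑-permutations-const (removeAt xs i) p) ⟩
    ∑ (allFin (suc n)) (λ i → fromℕ (n !) * p)                               ≈⟨ ∑-allFin-const (suc n) _ ⟩
    fromℕ (suc n) * (fromℕ (n !) * p)                                        ≈⟨ *-assoc _ _ _ ⟨
    fromℕ (suc n) * fromℕ (n !) * p                                          ≈⟨ *-congʳ (Multiples.×1-homo-* semiring (suc n) (n !)) ⟨
    fromℕ (suc n !) * p                                                      ∎
    where open SetoidReasoning setoid

-- Convexity, weighted means and the threshold estimate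

module Inequalities {c ℓ₁ ℓ₂} (R : OrderedField c ℓ₁ ℓ₂) where
  open OrderedField R
  open OrderedFieldProperties R
  open ListSum R
  open ℤ-Solver using (solve; _:=_; con; _:+_; _:*_; _:-_)
  open ≤-Reasoning

  convex-≤ : ∀ {q x y z} → 0# ≤ q → q ≤ 1# → x ≤ z → y ≤ z → q * x + (1# + - q) * y ≤ z
  convex-≤ {q} {x} {y} {z} 0≤q q≤1 x≤z y≤z =
    ≤-by (+-nonNegative (*-nonNegative 0≤q (0≤y-x x≤z)) (*-nonNegative (0≤y-x q≤1) (0≤y-x y≤z)))
      (solve 4 (λ q x y z → z :- (q :* x :+ (con (+ 1) :- q) :* y)
                         := q :* (z :- x) :+ (con (+ 1) :- q) :* (z :- y)) refl q x y z)

  ∑-deviation : ∀ (w : A → Carrier) xs p (f : A → Carrier) →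
    ∑ xs (λ x → w x * (p + - f x)) ≈ ∑ xs w * p + - ∑ xs (λ x → w x * f x)
  ∑-deviation w []       p f = solve 1 (λ p → con (+ 0) := con (+ 0) :* p :- con (+ 0)) refl p
  ∑-deviation w (x ∷ xs) p f = trans (+-congˡ (∑-deviation w xs p f))
    (solve 5 (λ w p f k t → w :* (p :- f) :+ (k :* p :- t) := (w :+ k) :* p :- (w :* f :+ t))
       refl (w x) p (f x) (∑ xs w) (∑ xs (λ x → w x * f x)))

  -- When the total weight vanishes, so does the weighted sum, and any τ will do.
  weightedMean : ∀ (w : A → Carrier) xs (f : A → Carrier) p → (∀ x → 0# ≤ w x) → (∀ x → 0# ≤ f x) → (∀ x → f x ≤ p) →
    Σ[ τ ∈ Carrier ] ∑ xs w * τ ≈ ∑ xs (λ x → w x * f x)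
  weightedMean w xs f p 0≤w 0≤f f≤p with ∑ xs w ≟ 0#
  ... | no  k≉0 = _ , trans (solve 3 (λ k t i → k :* (i :* t) := (k :* i) :* t) refl (∑ xs w) (∑ xs (λ x → w x * f x)) (∑ xs w ⁻¹))
                        (trans (*-congʳ (⁻¹-inverseʳ k≉0)) (*-identityˡ _))
  ... | yes k≈0 = 0# , trans (zeroʳ _) (≤-antisym (∑-nonNegative xs (λ x → *-nonNegative (0≤w x) (0≤f x))) (begin
    ∑ xs (λ x → w x * f x)  ≤⟨ ∑-mono-≤ xs (λ x → *-monoˡ-≤ (0≤w x) (f≤p x)) ⟩
    ∑ xs (λ x → w x * p)    ≈⟨ ∑-cong xs (λ x → *-comm (w x) p) ⟩
    ∑ xs (λ x → p * w x)    ≈⟨ ∑-*ˡ xs p w ⟩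
    p * ∑ xs w              ≈⟨ *-congˡ k≈0 ⟩
    p * 0#                  ≈⟨ zeroʳ p ⟩
    0#                      ∎))

  -- A Chebyshev-type estimate: opening probabilities q grow with the distance s
  -- to the centre, but no faster than the credit s + s paid on arrival allows.
  thresholdBound : ∀ {q s δ τ k h} → 0# ≤ q → 0# ≤ s → 0# ≤ k → q ≤ δ + s → δ ≤ q + s →
    h ≤ 1# → h ≤ k * (s ⊓ δ + - τ) → q * h ≤ (s + s) + (δ + - τ) * (k * (s ⊓ δ + - τ))
  thresholdBound {q} {s} {δ} {τ} {k} {h} 0≤q 0≤s 0≤k q≤δ+s δ≤q+s h≤1 h≤ℓ with total τ (s ⊓ δ)
  -- Write `ρ` for `s ⊓ δ` and `ℓ` for `k * (ρ + - τ)`. Here `ℓ` is nonnegative, and `m = 1# ⊓ ℓ`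
  -- satisfies `h ≤ m`. Replacing `h` and `ℓ` by `m`, and `s + s` by its multiple by `m`, leaves `m`
  -- times `(δ + s - q) + (s - τ)`, which is nonnegative because `τ ≤ ρ ≤ s`.
  ... | inj₁ τ≤ρ = ≤-by
    (+-nonNegative
      (+-nonNegative
        (+-nonNegative
          (*-nonNegative (+-nonNegative (0≤y-x (x⊓y≤y s δ)) (0≤y-x τ≤ρ)) (0≤y-x (x⊓y≤y 1# (k * (s ⊓ δ + - τ)))))
          (*-nonNegative 0≤q (0≤y-x (⊓-glb h≤1 h≤ℓ))))
        (*-nonNegative (+-nonNegative 0≤s 0≤s) (0≤y-x (x⊓y≤x 1# (k * (s ⊓ δ + - τ))))))
      (*-nonNegative
        (⊓-glb 0≤1 (*-nonNegative 0≤k (0≤y-x τ≤ρ)))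
        (+-nonNegative (+-nonNegative (0≤y-x q≤δ+s) (0≤y-x (x⊓y≤x s δ))) (0≤y-x τ≤ρ))))
    (solve 8 (λ q s δ τ ℓ h ρ m →
        (s :+ s) :+ (δ :- τ) :* ℓ :- q :* h
          := ((δ :- ρ) :+ (ρ :- τ)) :* (ℓ :- m) :+ q :* (m :- h) :+ (s :+ s) :* (con (+ 1) :- m)
             :+ m :* ((δ :+ s :- q) :+ (s :- ρ) :+ (ρ :- τ)))
      refl q s δ τ (k * (s ⊓ δ + - τ)) h (s ⊓ δ) (1# ⊓ (k * (s ⊓ δ + - τ))))
  -- Now `ℓ` is at most zero and `q * h ≤ q * ℓ`, so it is enough that `δ - τ ≤ q`. If `ρ` is `s`,
  -- this follows from `δ ≤ q + s` and `s ≤ τ`; if `ρ` is `δ`, then already `δ ≤ τ`.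
  ... | inj₂ ρ≤τ with ⊓-sel s δ
  ...   | inj₁ ρ≈s = ≤-by
    (+-nonNegative
      (+-nonNegative
        (*-nonNegative 0≤q (0≤y-x h≤ℓ))
        (*-nonNegative (*-nonNegative 0≤k (0≤y-x ρ≤τ))
          (+-nonNegative (+-nonNegative (0≤y-x δ≤q+s) (0≤y-x ρ≤τ)) (0≤y-x (≤-reflexive (sym ρ≈s))))))
      (+-nonNegative 0≤s 0≤s))
    (solve 7 (λ q s δ τ k h ρ →
        (s :+ s) :+ (δ :- τ) :* (k :* (ρ :- τ)) :- q :* h
          := q :* (k :* (ρ :- τ) :- h) :+ k :* (τ :- ρ) :* ((q :+ s :- δ) :+ (τ :- ρ) :+ (ρ :- s)) :+ (s :+ s))
      refl q s δ τ k h (s ⊓ δ))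
  ...   | inj₂ ρ≈δ = ≤-by
    (+-nonNegative
      (+-nonNegative
        (*-nonNegative 0≤q (0≤y-x h≤ℓ))
        (*-nonNegative (*-nonNegative 0≤k (0≤y-x ρ≤τ))
          (+-nonNegative (+-nonNegative 0≤q (0≤y-x ρ≤τ)) (0≤y-x (≤-reflexive (sym ρ≈δ))))))
      (+-nonNegative 0≤s 0≤s))
    (solve 7 (λ q s δ τ k h ρ →
        (s :+ s) :+ (δ :- τ) :* (k :* (ρ :- τ)) :- q :* h
          := q :* (k :* (ρ :- τ) :- h) :+ k :* (τ :- ρ) :* (q :+ (τ :- ρ) :+ (ρ :- δ)) :+ (s :+ s))
      refl q s δ τ k h (s ⊓ δ))

-- The opening probability as a function of the point

module OpeningProbability {c ℓ₁ ℓ₂ a ℓ} (R : OrderedField c ℓ₁ ℓ₂) (M : MetricSpace R a ℓ) where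
  open OrderedField R
  open FacilityLocation R M
  open OrderedFieldProperties R
  open IsGeneralMetric isMetric using (nonNegative; triangle) renaming (sym to d-sym)

  P : Facilities → Point → Carrier
  P F v = openProb (dist F v)

  half : Point → Point → Carrier
  half u v = ½ * d u v

  0≤half : ∀ u v → 0# ≤ half u v
  0≤half u v = ½-nonNegative nonNegative

  half-sym : ∀ u v → half u v ≈ half v u
  half-sym u v = *-congˡ (d-sym u v)

  half-triangle : ∀ u v w → half u w ≤ half u v + half v w
  half-triangle u v w = ≤-respʳ-≈ (distribˡ ½ _ _) (*-monoˡ-≤ 0≤½ (triangle u v w))

  openProb-≤1 : ∀ x → openProb x ≤ 1#
  openProb-≤1 Add⁺.[ x ] = x⊓y≤y _ _
  openProb-≤1 ⊤⁺         = ≤-refl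

  openProb-⊓⁺-≤ˡ : ∀ x y → openProb (fin x ⊓⁺ y) ≤ ½ * x
  openProb-⊓⁺-≤ˡ x Add⁺.[ y ] = ≤-trans (x⊓y≤x _ _) (*-monoˡ-≤ 0≤½ (x⊓y≤x x y))
  openProb-⊓⁺-≤ˡ x ⊤⁺         = x⊓y≤x _ _

  openProb-⊓⁺-≤ʳ : ∀ x y → openProb (fin x ⊓⁺ y) ≤ openProb y
  openProb-⊓⁺-≤ʳ x Add⁺.[ y ] = ⊓-mono-≤ (*-monoˡ-≤ 0≤½ (x⊓y≤y x y)) ≤-refl
  openProb-⊓⁺-≤ʳ x ⊤⁺         = x⊓y≤y _ _

  -- When the cap `1#` is attained, the second alternative holds, because no opening probability
  -- exceeds `1#`. In inductions over the open facilities this tells whether the head or the tail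
  -- determines the probability.
  openProb-⊓⁺-sel : ∀ x y → ½ * x ≤ openProb (fin x ⊓⁺ y) ⊎ openProb y ≤ openProb (fin x ⊓⁺ y)
  openProb-⊓⁺-sel x Add⁺.[ y ] with ⊓-sel (½ * (x ⊓ y)) 1# | ⊓-sel x y
  ... | inj₂ p≈1 | _          = inj₂ (≤-trans (x⊓y≤y _ _) (≤-reflexive (sym p≈1)))
  ... | inj₁ p≈m | inj₁ m≈x   = inj₁ (≤-reflexive (sym (trans p≈m (*-congˡ m≈x))))
  ... | inj₁ p≈m | inj₂ m≈y   = inj₂ (≤-trans (x⊓y≤x _ _) (≤-reflexive (sym (trans p≈m (*-congˡ m≈y)))))
  openProb-⊓⁺-sel x ⊤⁺ with ⊓-sel (½ * x) 1#
  ... | inj₁ p≈½x = inj₁ (≤-reflexive (sym p≈½x))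
  ... | inj₂ p≈1  = inj₂ (≤-reflexive (sym p≈1))

  0≤P : ∀ F v → 0# ≤ P F v
  0≤P []      v = 0≤1
  0≤P (u ∷ F) v with openProb-⊓⁺-sel (d u v) (dist F v)
  ... | inj₁ ½d≤P = ≤-trans (0≤half u v) ½d≤P
  ... | inj₂ P≤P  = ≤-trans (0≤P F v) P≤P

  P≤1 : ∀ F v → P F v ≤ 1#
  P≤1 F v = openProb-≤1 (dist F v)

  P-∷-≤-half : ∀ u F v → P (u ∷ F) v ≤ half u v
  P-∷-≤-half u F v = openProb-⊓⁺-≤ˡ (d u v) (dist F v)

  P-∷-≤ : ∀ u F v → P (u ∷ F) v ≤ P F v
  P-∷-≤ u F v = openProb-⊓⁺-≤ʳ (d u v) (dist F v)

  -- `P F` is the minimum of the constant `1#` and the functions `half u` for `u` in `F`, each of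
  -- which satisfies the bound by the triangle inequality. With no facility open only the constant
  -- remains.
  P-lipschitz : ∀ F v w → P F w ≤ P F v + half v w
  P-lipschitz []      v w = ≤-respˡ-≈ (+-identityʳ 1#) (+-monoʳ-≤ 1# (0≤half v w))
  P-lipschitz (u ∷ F) v w with openProb-⊓⁺-sel (d u v) (dist F v)
  ... | inj₁ ½d≤P = ≤-trans (P-∷-≤-half u F w) (≤-trans (half-triangle u v w) (+-mono-≤ ½d≤P ≤-refl))
  ... | inj₂ P≤P  = ≤-trans (P-∷-≤ u F w) (≤-trans (P-lipschitz F v w) (+-mono-≤ P≤P ≤-refl))

-- Expected openings under a random arrival order

module Openings {c ℓ₁ ℓ₂ a ℓ} (R : OrderedField c ℓ₁ ℓ₂) (M : MetricSpace R a ℓ) where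
  open OrderedField R
  open FacilityLocation R M
  open OrderedFieldProperties R
  open ListSum R
  open Inequalities R
  open OpeningProbability R M
  open ℤ-Solver using (solve; _:=_; con; _:+_; _:*_; :-_; _:-_)
  open ≤-Reasoning

  -- For a fixed arrival order, the expectation over the coins of the number of openings at demands
  -- selected by `χ`. The other demands are not counted, but their openings still change the
  -- facilities.
  openings : (Point → Bool) → Facilities → Vec Point n → Carrier
  openings χ F []       = 0#
  openings χ F (v ∷ vs) =
    P F v * (indicator (χ v) + openings χ (v ∷ F) vs) + (1# + - P F v) * openings χ F vs

  -- A supermartingale argument: `step` says that, on average over the next demand and its coin, the
  -- openings of one round plus the new potential are at most the old potential, and induction on
  -- the number of demands iterates this. Sums and the factor `n !` replace averages to avoid
  -- division.
  ∑-openings-≤ : ∀ (χ : Point → Bool) (Φ : ∀ {n} → Facilities → Vec Point n → Carrier) →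
    (∀ F → 0# ≤ Φ F []) →
    (∀ {n} F (U : Vec Point (suc n)) →
      ∑ (allFin (suc n)) (λ i →
        let v = lookup U i; V = removeAt U i in
        P F v * (indicator (χ v) + Φ (v ∷ F) V) + (1# + - P F v) * Φ F V)
      ≤ fromℕ (suc n) * Φ F U) →
    ∀ {n} F (U : Vec Point n) → ∑ (permutations U) (openings χ F) ≤ fromℕ (n !) * Φ F U
  ∑-openings-≤ χ Φ base step {0} F [] = begin
    0# + 0#            ≈⟨ +-identityʳ 0# ⟩
    0#                 ≤⟨ base F ⟩
    Φ F []             ≈⟨ solve 1 (λ x → x := (con (+ 1) :+ con (+ 0)) :* x) refl (Φ F []) ⟩
    fromℕ 1 * Φ F []   ∎
  ∑-openings-≤ χ Φ base step {suc n} F U = begin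
    ∑ (permutations U) (openings χ F)
      ≈⟨ ∑-permutations U (openings χ F) ⟩
    ∑ (allFin (suc n)) (λ i → ∑ (permutations (removeAt U i)) (λ vs → openings χ F (lookup U i ∷ vs)))
      ≤⟨ ∑-mono-≤ (allFin (suc n)) bound ⟩
    ∑ (allFin (suc n)) (λ i → fromℕ (n !) * term i)
      ≈⟨ ∑-*ˡ (allFin (suc n)) (fromℕ (n !)) term ⟩
    fromℕ (n !) * ∑ (allFin (suc n)) term
      ≤⟨ *-monoˡ-≤ (0≤fromℕ (n !)) (step F U) ⟩
    fromℕ (n !) * (fromℕ (suc n) * Φ F U)
      ≈⟨ solve 3 (λ f k x → f :* (k :* x) := k :* f :* x) refl (fromℕ (n !)) (fromℕ (suc n)) (Φ F U) ⟩
    fromℕ (suc n) * fromℕ (n !) * Φ F U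
      ≈⟨ *-congʳ (Multiples.×1-homo-* semiring (suc n) (n !)) ⟨
    fromℕ (suc n !) * Φ F U
      ∎
    where
    term : Fin (suc n) → Carrier
    term i = let v = lookup U i; V = removeAt U i in
      P F v * (indicator (χ v) + Φ (v ∷ F) V) + (1# + - P F v) * Φ F V

    bound : ∀ i → ∑ (permutations (removeAt U i)) (λ vs → openings χ F (lookup U i ∷ vs)) ≤ fromℕ (n !) * term i
    bound i = begin
      ∑ π (λ vs → q * (x + openings χ (v ∷ F) vs) + (1# + - q) * openings χ F vs)
        ≈⟨ ∑-+ π _ _ ⟩
      ∑ π (λ vs → q * (x + openings χ (v ∷ F) vs)) + ∑ π (λ vs → (1# + - q) * openings χ F vs)
        ≈⟨ +-cong (trans (∑-*ˡ π q _) (*-congˡ (trans (∑-+ π _ _) (+-congʳ (∑-permutations-const V x)))))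
                  (∑-*ˡ π (1# + - q) _) ⟩
      q * (fromℕ (n !) * x + ∑ π (openings χ (v ∷ F))) + (1# + - q) * ∑ π (openings χ F)
        ≤⟨ +-mono-≤ (*-monoˡ-≤ (0≤P F v) (+-monoʳ-≤ _ (∑-openings-≤ χ Φ base step (v ∷ F) V)))
                    (*-monoˡ-≤ (0≤y-x (P≤1 F v)) (∑-openings-≤ χ Φ base step F V)) ⟩
      q * (fromℕ (n !) * x + fromℕ (n !) * Φ (v ∷ F) V) + (1# + - q) * (fromℕ (n !) * Φ F V)
        ≈⟨ solve 5 (λ q f x y z → q :* (f :* x :+ f :* y) :+ (con (+ 1) :- q) :* (f :* z)
                                := f :* (q :* (x :+ y) :+ (con (+ 1) :- q) :* z))
             refl q (fromℕ (n !)) x (Φ (v ∷ F) V) (Φ F V) ⟩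
      fromℕ (n !) * term i
        ∎
      where
      v = lookup U i
      V = removeAt U i
      π = permutations V
      q = P F v
      x = indicator (χ v)

  -- The potential of a single cluster

  module Cluster (centre : Point) (χ : Point → Bool) where
    w s credit : Point → Carrier
    w v      = indicator (χ v)
    s        = half centre
    credit v = w v * (s v + s v)

    δ : Facilities → Carrier
    δ F = P F centre

    remainingCredit : Vec Point n → Carrier
    remainingCredit U = ∑ (toList U) credit

    -- The deviations are not truncated at zero, so this may be negative; the credit makes up for
    -- it, since `δ F - s v` plus `s v + s v` is nonnegative.
    slope : Facilities → Vec Point n → Carrier
    slope F U = ∑ (toList U) (λ v → w v * (δ F + - s v))

    potential : Facilities → Vec Point n → Carrier
    potential F U = remainingCredit U + (1# ⊓ slope F U)

    0≤w : ∀ v → 0# ≤ w v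
    0≤w v = 0≤indicator (χ v)

    P≤δ+s : ∀ F v → P F v ≤ δ F + s v
    P≤δ+s F v = P-lipschitz F centre v

    δ≤P+s : ∀ F v → δ F ≤ P F v + s v
    δ≤P+s F v = ≤-respʳ-≈ (+-congˡ (half-sym v centre)) (P-lipschitz F v centre)

    slope-∷-≤ : ∀ u F (V : Vec Point n) → slope (u ∷ F) V ≤ slope F V
    slope-∷-≤ u F V = ∑-mono-≤ (toList V) (λ v → *-monoˡ-≤ (0≤w v) (+-monoˡ-≤ (- s v) (P-∷-≤ u F centre)))

    module Step (F : Facilities) (U : Vec Point (suc n)) where
      q : Point → Carrier
      q = P F

      term : Fin (suc n) → Carrier
      term i = let v = lookup U i; V = removeAt U i in
        q v * (w v + potential (v ∷ F) V) + (1# + - q v) * potential F V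

      -- This bound holds for each demand separately. Opening only lowers `δ`, so both outcomes of
      -- the coin leave a slope of at most `slope F V`. Removing `v` releases `w v` times
      -- `(s v + s v) + (δ F - s v) = δ F + s v`, which covers the expected opening `q v * w v`.
      term-≤-slope : ∀ i → term i ≤ remainingCredit U + slope F U
      term-≤-slope i = begin
        q v * (w v + potential (v ∷ F) V) + (1# + - q v) * potential F V
          ≈⟨ solve 4 (λ q w x y → q :* (w :+ x) :+ (con (+ 1) :- q) :* y := q :* w :+ (q :* x :+ (con (+ 1) :- q) :* y))
               refl (q v) (w v) (potential (v ∷ F) V) (potential F V) ⟩
        q v * w v + (q v * potential (v ∷ F) V + (1# + - q v) * potential F V)
          ≤⟨ +-monoʳ-≤ _ (convex-≤ (0≤P F v) (P≤1 F v)
               (+-monoʳ-≤ _ (≤-trans (x⊓y≤y 1# _) (slope-∷-≤ v F V)))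
               (+-monoʳ-≤ _ (x⊓y≤y 1# _))) ⟩
        q v * w v + (remainingCredit V + slope F V)
          ≤⟨ ≤-by (*-nonNegative (0≤w v) (0≤y-x (P≤δ+s F v)))
               (solve 6 (λ q w s δ r l →
                   w :* (s :+ s) :+ r :+ (w :* (δ :- s) :+ l) :- (q :* w :+ (r :+ l)) := w :* (δ :+ s :- q))
                 refl (q v) (w v) (s v) (δ F) (remainingCredit V) (slope F V)) ⟩
        (credit v + remainingCredit V) + (w v * (δ F + - s v) + slope F V)
          ≈⟨ +-cong (∑-removeAt U i credit) (∑-removeAt U i _) ⟨
        remainingCredit U + slope F U
          ∎
        where
        v = lookup U i
        V = removeAt U i

      us : List Point
      us = toList U

      -- An upper bound for `δ` once a facility has been opened at `v`.
      ρ : Point → Carrier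
      ρ v = s v ⊓ δ F

      k : Carrier
      k = ∑ us w

      mean : Σ[ τ ∈ Carrier ] k * τ ≈ ∑ us (λ v → w v * ρ v)
      mean = weightedMean w us ρ (δ F) 0≤w (λ v → ⊓-glb (0≤half centre v) (0≤P F centre)) (λ v → x⊓y≤y _ _)

      τ : Carrier
      τ = proj₁ mean

      gain : Point → Carrier
      gain v = k * (ρ v + - τ)

      0≤k : 0# ≤ k
      0≤k = ∑-nonNegative us 0≤w

      -- Deviations from the weighted mean `τ` cancel. This cancellation is what the uniformly
      -- random choice of the next demand provides.
      ∑-gain : ∑ us (λ v → w v * gain v) ≈ 0#
      ∑-gain = begin-equality
        ∑ us (λ v → w v * (k * (ρ v + - τ)))
          ≈⟨ ∑-cong us (λ v → solve 4 (λ w k r t → w :* (k :* (r :- t)) := :- k :* (w :* (t :- r))) refl (w v) k (ρ v) τ) ⟩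
        ∑ us (λ v → - k * (w v * (τ + - ρ v)))             ≈⟨ ∑-*ˡ us (- k) _ ⟩
        - k * ∑ us (λ v → w v * (τ + - ρ v))               ≈⟨ *-congˡ (∑-deviation w us τ ρ) ⟩
        - k * (k * τ + - ∑ us (λ v → w v * ρ v))           ≈⟨ *-congˡ (+-congʳ (proj₂ mean)) ⟩
        - k * (∑ us (λ v → w v * ρ v) + - ∑ us (λ v → w v * ρ v))
          ≈⟨ solve 2 (λ k t → :- k :* (t :- t) := con (+ 0)) refl k _ ⟩
        0#                                                 ∎

      -- Opening at `v` brings `δ` down to at most `ρ v`, while every `s u` is at least `ρ u`. The
      -- resulting sum of `w u * (ρ v + - ρ u)` is `k` times the deviation of `ρ v` from the mean.
      slope-≤-gain : ∀ i → slope (lookup U i ∷ F) (removeAt U i) ≤ gain (lookup U i)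
      slope-≤-gain i = begin
        ∑ (toList V) (λ u → w u * (δ (v ∷ F) + - s u))
          ≤⟨ ∑-mono-≤ (toList V) (λ u → *-monoˡ-≤ (0≤w u) (deviation-≤ u)) ⟩
        ∑ (toList V) (λ u → w u * (ρ v + - ρ u))
          -- The demand `v` itself would contribute zero, so the sum can be extended from `V` to all
          -- of `U`.
          ≈⟨ solve 3 (λ w r x → x := w :* (r :- r) :+ x) refl (w v) (ρ v) _ ⟩
        w v * (ρ v + - ρ v) + ∑ (toList V) (λ u → w u * (ρ v + - ρ u))
          ≈⟨ ∑-removeAt U i _ ⟨
        ∑ us (λ u → w u * (ρ v + - ρ u))
          ≈⟨ ∑-deviation w us (ρ v) ρ ⟩
        k * ρ v + - ∑ us (λ u → w u * ρ u)
          ≈⟨ +-congˡ (-‿cong (proj₂ mean)) ⟨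
        k * ρ v + - (k * τ)
          ≈⟨ solve 3 (λ k r t → k :* r :- k :* t := k :* (r :- t)) refl k (ρ v) τ ⟩
        gain v
          ∎
        where
        v = lookup U i
        V = removeAt U i

        deviation-≤ : ∀ u → δ (v ∷ F) + - s u ≤ ρ v + - ρ u
        deviation-≤ u = ≤-by
          (+-nonNegative
            (0≤y-x (⊓-glb (≤-respʳ-≈ (half-sym v centre) (P-∷-≤-half v F centre)) (P-∷-≤ v F centre)))
            (0≤y-x (x⊓y≤x (s u) (δ F))))
          (solve 4 (λ d s r t → r :- t :- (d :- s) := (r :- d) :+ (s :- t)) refl (δ (v ∷ F)) (s u) (ρ v) (ρ u))

      -- If `v` is not opened, the minimum in the potential is bounded by `1#`. For a member of the
      -- cluster the left side then becomes `r + 1# + q v * h`, and `thresholdBound` controls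
      -- `q v * h`; for a nonmember `h ≤ 1#` is enough. The excess over `remainingCredit U + 1#` is
      -- a fixed multiple of `w v * gain v`, which `∑-gain` removes in the sum.
      term-≤-one : ∀ i → term i ≤ remainingCredit U + 1# + (δ F + - τ) * (w (lookup U i) * gain (lookup U i))
      term-≤-one i = begin
        q v * (w v + (r + h)) + (1# + - q v) * potential F V
          ≤⟨ +-monoʳ-≤ _ (*-monoˡ-≤ (0≤y-x (P≤1 F v)) (+-monoʳ-≤ r (x⊓y≤x 1# _))) ⟩
        q v * (w v + (r + h)) + (1# + - q v) * (r + 1#)
          ≤⟨ member? (χ v) ⟩
        credit v + r + 1# + (δ F + - τ) * (w v * gain v)
          ≈⟨ +-congʳ (+-congʳ (∑-removeAt U i credit)) ⟨
        remainingCredit U + 1# + (δ F + - τ) * (w v * gain v)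
          ∎
        where
        v = lookup U i
        V = removeAt U i
        r = remainingCredit V
        h = 1# ⊓ slope (v ∷ F) V

        member? : ∀ b → q v * (indicator b + (r + h)) + (1# + - q v) * (r + 1#)
          ≤ indicator b * (s v + s v) + r + 1# + (δ F + - τ) * (indicator b * gain v)
        member? true  = ≤-by
          (0≤y-x (thresholdBound {q = q v} {s v} {δ F} {τ} {k} {h} (0≤P F v) (0≤half centre v) 0≤k
            (P≤δ+s F v) (δ≤P+s F v) (x⊓y≤x 1# _) (≤-trans (x⊓y≤y 1# _) (slope-≤-gain i))))
          (solve 6 (λ q s r h e g →
              con (+ 1) :* (s :+ s) :+ r :+ con (+ 1) :+ e :* (con (+ 1) :* g)
                :- (q :* (con (+ 1) :+ (r :+ h)) :+ (con (+ 1) :- q) :* (r :+ con (+ 1)))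
              := (s :+ s) :+ e :* g :- q :* h)
            refl (q v) (s v) r h (δ F + - τ) (gain v))
        member? false = ≤-by
          (*-nonNegative (0≤P F v) (0≤y-x (x⊓y≤x 1# (slope (v ∷ F) V))))
          (solve 6 (λ q s r h e g →
              con (+ 0) :* (s :+ s) :+ r :+ con (+ 1) :+ e :* (con (+ 0) :* g)
                :- (q :* (con (+ 0) :+ (r :+ h)) :+ (con (+ 1) :- q) :* (r :+ con (+ 1)))
              := q :* (con (+ 1) :- h))
            refl (q v) (s v) r h (δ F + - τ) (gain v))

      ∑-term-≤-one : ∑ (allFin (suc n)) term ≤ fromℕ (suc n) * (remainingCredit U + 1#)
      ∑-term-≤-one = begin
        ∑ (allFin (suc n)) term
          ≤⟨ ∑-mono-≤ (allFin (suc n)) term-≤-one ⟩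
        ∑ (allFin (suc n)) (λ i → remainingCredit U + 1# + (δ F + - τ) * (w (lookup U i) * gain (lookup U i)))
          ≈⟨ ∑-+ (allFin (suc n)) _ _ ⟩
        ∑ (allFin (suc n)) (λ _ → remainingCredit U + 1#)
          + ∑ (allFin (suc n)) (λ i → (δ F + - τ) * (w (lookup U i) * gain (lookup U i)))
          ≈⟨ +-cong (∑-allFin-const (suc n) _)
               (trans (∑-*ˡ (allFin (suc n)) (δ F + - τ) _)
                 (*-congˡ (trans (∑-lookup U (λ v → w v * gain v)) ∑-gain))) ⟩
        fromℕ (suc n) * (remainingCredit U + 1#) + (δ F + - τ) * 0#
          ≈⟨ solve 2 (λ x y → x :+ y :* con (+ 0) := x) refl _ (δ F + - τ) ⟩
        fromℕ (suc n) * (remainingCredit U + 1#)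
          ∎

      ∑-term-≤-slope : ∑ (allFin (suc n)) term ≤ fromℕ (suc n) * (remainingCredit U + slope F U)
      ∑-term-≤-slope = ≤-respʳ-≈ (∑-allFin-const (suc n) _) (∑-mono-≤ (allFin (suc n)) term-≤-slope)

      ∑-term-≤ : ∑ (allFin (suc n)) term ≤ fromℕ (suc n) * potential F U
      ∑-term-≤ with ⊓-sel 1# (slope F U)
      ... | inj₁ ⊓≈1     = ≤-respʳ-≈ (*-congˡ (+-congˡ (sym ⊓≈1))) ∑-term-≤-one
      ... | inj₂ ⊓≈slope = ≤-respʳ-≈ (*-congˡ (+-congˡ (sym ⊓≈slope))) ∑-term-≤-slope

    -- The minimum in the initial potential is at most `1#`: this unit is charged to the one
    -- facility that the solution opens at the centre.
    ∑-openings-≤-credit : ∀ F (U : Vec Point n) →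
      ∑ (permutations U) (openings χ F) ≤ fromℕ (n !) * (remainingCredit U + 1#)
    ∑-openings-≤-credit {n = n} F U = ≤-trans
      (∑-openings-≤ χ potential (λ F → +-nonNegative ≤-refl (⊓-glb 0≤1 ≤-refl)) Step.∑-term-≤ F U)
      (*-monoˡ-≤ (0≤fromℕ (n !)) (+-monoʳ-≤ _ (x⊓y≤x 1# _)))

-- Expectations of costs that may be infinite

module Expectation {c ℓ₁ ℓ₂} (R : OrderedField c ℓ₁ ℓ₂) where
  open OrderedField R
  open Extended R
  open Probability R
  open OrderedFieldProperties R
  open ListSum R
  open ℤ-Solver using (solve; _:=_; con; _:+_; _:*_)

  Finite : Carrier ⁺ → Set c
  Finite x = ∃[ y ] x ≡ fin y

  -- The value at infinity is a default; in the expectation of an almost finite distribution it is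
  -- multiplied by a weight equal to zero.
  finitePart : Carrier ⁺ → Carrier
  finitePart Add⁺.[ x ] = x
  finitePart ⊤⁺         = 0#

  infix 4 _≐_
  _≐_ : Carrier ⁺ → Carrier → Set _
  x ≐ y = ∃[ z ] (x ≡ fin z) Product.× (z ≈ y)

  ≐-resp-≈ : ∀ {x y z} → x ≐ y → y ≈ z → x ≐ z
  ≐-resp-≈ (u , x≡u , u≈y) y≈z = u , x≡u , trans u≈y y≈z

  +⁺-≐ : ∀ {x y u v} → x ≐ u → y ≐ v → x +⁺ y ≐ u + v
  +⁺-≐ (_ , ≡.refl , p) (_ , ≡.refl , q) = _ , ≡.refl , +-cong p q

  ·-≐ : ∀ p x → p ≈ 0# ⊎ Finite x → p · x ≐ p * finitePart x
  ·-≐ p Add⁺.[ x ] _ = _ , ≡.refl , refl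
  ·-≐ p ⊤⁺ (inj₁ p≈0) with p ≟ 0#
  ... | yes _  = 0# , ≡.refl , sym (zeroʳ p)
  ... | no p≉0 = contradiction p≈0 p≉0

  expect : Dist A → (A → Carrier) → Carrier
  expect D f = ∑ D (λ (p , x) → p * f x)

  -- Infinite outcomes do occur in the lists: not opening at the very first demand leaves it at
  -- infinite distance, with weight zero.
  AlmostFinite : Dist (Carrier ⁺) → Set _
  AlmostFinite = All (λ (p , x) → p ≈ 0# ⊎ Finite x)

  E-≐ : ∀ {D} → AlmostFinite D → E D ≐ expect D finitePart
  E-≐ []                              = 0# , ≡.refl , refl
  E-≐ (_∷_ {x = p , x} finite finites) = +⁺-≐ (·-≐ p x finite) (E-≐ finites)

  expect-cong : ∀ (D : Dist A) {f g : A → Carrier} → (∀ x → f x ≈ g x) → expect D f ≈ expect D g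
  expect-cong D f≈g = ∑-cong D (λ (p , x) → *-congˡ (f≈g x))

  expect->>= : ∀ (D : Dist A) (f : A → Dist B) (g : B → Carrier) →
               expect (D >>= f) g ≈ expect D (λ x → expect (f x) g)
  expect->>= []            f g = refl
  expect->>= ((p , x) ∷ D) f g = trans (∑-++ (List.map _ (f x)) (D >>= f) _)
    (+-cong
      (trans (reflexive (∑-map _ (f x) _))
        (trans (∑-cong (f x) (λ (q , y) → *-assoc p q (g y))) (∑-*ˡ (f x) p _)))
      (expect->>= D f g))

  expect-pure : ∀ (x : A) f → expect (pure x) f ≈ f x
  expect-pure x f = trans (+-identityʳ _) (*-identityˡ _)

  AlmostFinite->>= : ∀ {D : Dist A} {f : A → Dist (Carrier ⁺)} →
                     All (λ (p , x) → p ≈ 0# ⊎ AlmostFinite (f x)) D → AlmostFinite (D >>= f)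
  AlmostFinite->>= []                                = []
  AlmostFinite->>= {f = f} (_∷_ {x = p , x} (inj₁ p≈0) rest) =
    All.++⁺ (All.map⁺ (All.universal (λ (q , y) → inj₁ (trans (*-congʳ p≈0) (zeroˡ q))) (f x))) (AlmostFinite->>= rest)
  AlmostFinite->>= (_∷_ {x = p , x} (inj₂ finite) rest) =
    All.++⁺ (All.map⁺ (All.map (λ { (inj₁ q≈0) → inj₁ (trans (*-congˡ q≈0) (zeroʳ p)) ; (inj₂ y) → inj₂ y }) finite))
            (AlmostFinite->>= rest)

  shift : Carrier ⁺ → Dist (Carrier ⁺) → Dist (Carrier ⁺)
  shift x D = D >>= λ y → pure (x +⁺ y)

  AlmostFinite-shift : ∀ {x D} → Finite x → AlmostFinite D → AlmostFinite (shift x D)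
  AlmostFinite-shift {x} (_ , ≡.refl) finite = AlmostFinite->>= {f = λ y → pure (x +⁺ y)}
    (All.map (λ { (inj₁ p≈0) → inj₁ p≈0 ; (inj₂ (_ , ≡.refl)) → inj₂ (inj₂ (_ , ≡.refl) ∷ []) }) finite)

  -- Adding `x` to every outcome adds `x` times the total weight, hence the condition that this
  -- weight is `1#`.
  expect-shift : ∀ {x D} → Finite x → AlmostFinite D → expect D (λ _ → 1#) ≈ 1# →
    expect (shift x D) finitePart ≈ finitePart x + expect D finitePart
  expect-shift {x} {D} (x′ , ≡.refl) finite mass =
    trans (expect->>= D (λ y → pure (x +⁺ y)) finitePart)
      (trans (expect-cong D (λ y → expect-pure (x +⁺ y) finitePart))
        (trans (additive finite) (+-congʳ (trans (*-congˡ mass) (*-identityʳ x′)))))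
    where
    additive : ∀ {D} → AlmostFinite D →
      expect D (λ y → finitePart (fin x′ +⁺ y)) ≈ x′ * expect D (λ _ → 1#) + expect D finitePart
    additive []                       = solve 1 (λ x → con (+ 0) := x :* con (+ 0) :+ con (+ 0)) refl x′
    additive (_∷_ {x = p , Add⁺.[ y ]} _ rest) = trans (+-congˡ (additive rest))
      (solve 5 (λ p x y m e → p :* (x :+ y) :+ (x :* m :+ e) := x :* (p :* con (+ 1) :+ m) :+ (p :* y :+ e)) refl p x′ y _ _)
    -- At infinity `finitePart` is not additive, so the weight has to be replaced by zero on both
    -- sides.
    additive (_∷_ {x = p , ⊤⁺} (inj₁ p≈0) rest) = trans (+-cong (*-congʳ p≈0) (additive rest))
      (trans (solve 3 (λ x m e → con (+ 0) :* con (+ 0) :+ (x :* m :+ e) := x :* (con (+ 0) :* con (+ 1) :+ m) :+ (con (+ 0) :* con (+ 0) :+ e)) refl x′ _ _)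
        (+-cong (*-congˡ (+-congʳ (*-congʳ (sym p≈0)))) (+-congʳ (*-congʳ (sym p≈0)))))
    additive (_∷_ {x = p , ⊤⁺} (inj₂ ()) rest)

-- Bounding the cost of a run by its openings

module CostOfRun {c ℓ₁ ℓ₂ a ℓ} (R : OrderedField c ℓ₁ ℓ₂) (M : MetricSpace R a ℓ) where
  open OrderedField R
  open FacilityLocation R M
  open OrderedFieldProperties R
  open ListSum R
  open Expectation R
  open OpeningProbability R M
  open Openings R M using (openings)
  open IsGeneralMetric isMetric using (≈⇒0; module EqC)
  open ℤ-Solver using (solve; _:=_; con; _:+_; _:*_; _:-_)
  open ≤-Reasoning

  finite-dist : ∀ u F v → Finite (dist (u ∷ F) v)
  finite-dist u F v with dist F v
  ... | Add⁺.[ x ] = _ , ≡.refl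
  ... | ⊤⁺         = _ , ≡.refl

  certain⊎finite : ∀ F v → P F v ≈ 1# ⊎ Finite (dist F v)
  certain⊎finite F v with dist F v
  ... | Add⁺.[ x ] = inj₂ (x , ≡.refl)
  ... | ⊤⁺         = inj₁ refl

  stayWeight≈0 : ∀ {p} → p ≈ 1# → (1# + - p) * 1# ≈ 0#
  stayWeight≈0 p≈1 = trans (*-identityʳ _) (trans (+-congˡ (-‿cong p≈1)) (-‿inverseʳ 1#))

  serve : Point → Vec Point n → Facilities → Dist (Carrier ⁺)
  serve v vs F = shift (dist F v) (run ½DistProb F vs)

  -- After an opening every distance is finite, and not opening at infinite distance has weight
  -- zero.
  run-almostFinite : ∀ F (vs : Vec Point n) → AlmostFinite (run ½DistProb F vs)
  run-almostFinite F []       = inj₂ (_ , ≡.refl) ∷ []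
  run-almostFinite F (v ∷ vs) = AlmostFinite->>= {f = serve v vs}
    (inj₂ (AlmostFinite-shift (finite-dist v F v) (run-almostFinite (v ∷ F) vs)) ∷ stay ∷ [])
    where
    stay : (1# + - P F v) * 1# ≈ 0# ⊎ AlmostFinite (serve v vs F)
    stay with certain⊎finite F v
    ... | inj₁ P≈1    = inj₁ (stayWeight≈0 P≈1)
    ... | inj₂ finite = inj₂ (AlmostFinite-shift finite (run-almostFinite F vs))

  run-mass : ∀ F (vs : Vec Point n) → expect (run ½DistProb F vs) (λ _ → 1#) ≈ 1#
  run-mass F []       = expect-pure (fin ∣ F ∣) (λ _ → 1#)
  run-mass F (v ∷ vs) = trans (expect->>= (½DistProb F v) (serve v vs) (λ _ → 1#))
    (trans (expect-cong (½DistProb F v) {g = λ _ → 1#} (λ F′ → trans (expect->>= (run ½DistProb F′ vs) (λ x → pure (dist F′ v +⁺ x)) (λ _ → 1#))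
        (trans (expect-cong (run ½DistProb F′ vs) (λ x → expect-pure (dist F′ v +⁺ x) (λ _ → 1#))) (run-mass F′ vs))))
      (solve 1 (λ p → p :* con (+ 1) :* con (+ 1) :+ ((con (+ 1) :- p) :* con (+ 1) :* con (+ 1) :+ con (+ 0)) := con (+ 1)) refl (P F v)))

  expectedCost : Facilities → Vec Point n → Carrier
  expectedCost F vs = expect (run ½DistProb F vs) finitePart

  -- While d(F,v) ≤ 2, the assignment cost d(F,v) is twice the opening
  -- probability; beyond that, v is served by its own facility.
  stayCost-≤ : ∀ F v → (1# + - P F v) * finitePart (dist F v) ≤ P F v + P F v
  stayCost-≤ F v = by-cases (dist F v) (0≤P F v)
    where
    by-cases : ∀ x → 0# ≤ openProb x → (1# + - openProb x) * finitePart x ≤ openProb x + openProb x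
    by-cases ⊤⁺ 0≤p = ≤-respˡ-≈ (sym (zeroʳ _)) (+-nonNegative 0≤p 0≤p)
    by-cases Add⁺.[ x ] 0≤p with ⊓-sel (½ * x) 1#
    ... | inj₂ p≈1 = ≤-respˡ-≈ (sym (trans (*-congʳ (trans (+-congˡ (-‿cong p≈1)) (-‿inverseʳ 1#))) (zeroˡ x)))
                       (+-nonNegative 0≤p 0≤p)
    ... | inj₁ p≈½x = begin
      (1# + - p) * x                  ≈⟨ *-congˡ (½x+½x≈x x) ⟨
      (1# + - p) * (½ * x + ½ * x)    ≈⟨ *-congˡ (+-cong p≈½x p≈½x) ⟨
      (1# + - p) * (p + p)            ≤⟨ ≤-by (*-nonNegative 0≤p (+-nonNegative 0≤p 0≤p))
                                           (solve 1 (λ p → p :+ p :- (con (+ 1) :- p) :* (p :+ p) := p :* (p :+ p)) refl p) ⟩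
      p + p                           ∎
      where p = openProb (fin x)

  dist-self-≤0 : ∀ F v → finitePart (dist (v ∷ F) v) ≤ 0#
  dist-self-≤0 F v with dist F v
  ... | Add⁺.[ x ] = ≤-trans (x⊓y≤x _ _) (≤-reflexive (≈⇒0 EqC.refl))
  ... | ⊤⁺         = ≤-reflexive (≈⇒0 EqC.refl)

  -- The opening fee is charged only at the end of the run, through the final number of facilities.
  -- An opened `v` is served at distance zero; otherwise `stayCost-≤` bounds the distance weighted
  -- by the probability of not opening.
  expectedCost-∷-≤ : ∀ F v (vs : Vec Point n) →
    expectedCost F (v ∷ vs) ≤ P F v * expectedCost (v ∷ F) vs + ((1# + - P F v) * expectedCost F vs + (P F v + P F v))
  expectedCost-∷-≤ F v vs = begin
    expectedCost F (v ∷ vs)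
      ≈⟨ expect->>= (½DistProb F v) (serve v vs) finitePart ⟩
    P F v * 1# * after (v ∷ F) + ((1# + - P F v) * 1# * after F + 0#)
      ≤⟨ +-mono-≤ opened (≤-respˡ-≈ (sym (+-identityʳ _)) stayed) ⟩
    P F v * expectedCost (v ∷ F) vs + ((1# + - P F v) * expectedCost F vs + (P F v + P F v))
      ∎
    where
    after : Facilities → Carrier
    after F′ = expect (serve v vs F′) finitePart

    after-≈ : ∀ F′ → Finite (dist F′ v) → after F′ ≈ finitePart (dist F′ v) + expectedCost F′ vs
    after-≈ F′ finite = expect-shift finite (run-almostFinite F′ vs) (run-mass F′ vs)

    opened : P F v * 1# * after (v ∷ F) ≤ P F v * expectedCost (v ∷ F) vs
    opened = begin
      P F v * 1# * after (v ∷ F)                                  ≈⟨ *-congʳ (*-identityʳ _) ⟩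
      P F v * after (v ∷ F)                                       ≈⟨ *-congˡ (after-≈ (v ∷ F) (finite-dist v F v)) ⟩
      P F v * (finitePart (dist (v ∷ F) v) + expectedCost (v ∷ F) vs)
        ≤⟨ *-monoˡ-≤ (0≤P F v) (≤-respʳ-≈ (+-identityˡ _) (+-mono-≤ (dist-self-≤0 F v) ≤-refl)) ⟩
      P F v * expectedCost (v ∷ F) vs                             ∎

    stayed : (1# + - P F v) * 1# * after F ≤ (1# + - P F v) * expectedCost F vs + (P F v + P F v)
    stayed with certain⊎finite F v
    ... | inj₁ P≈1 = begin
      (1# + - P F v) * 1# * after F                               ≈⟨ *-congʳ (stayWeight≈0 P≈1) ⟩
      0# * after F                                                ≈⟨ zeroˡ _ ⟩
      0#                                                          ≤⟨ +-nonNegative (0≤P F v) (0≤P F v) ⟩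
      P F v + P F v                                               ≈⟨ +-identityˡ _ ⟨
      0# + (P F v + P F v)                                        ≈⟨ +-congʳ (zeroˡ (expectedCost F vs)) ⟨
      0# * expectedCost F vs + (P F v + P F v)                    ≈⟨ +-congʳ (*-congʳ (stayWeight≈0 P≈1)) ⟨
      (1# + - P F v) * 1# * expectedCost F vs + (P F v + P F v)   ≈⟨ +-congʳ (*-congʳ (*-identityʳ _)) ⟩
      (1# + - P F v) * expectedCost F vs + (P F v + P F v)        ∎
    ... | inj₂ finite = begin
      (1# + - P F v) * 1# * after F                               ≈⟨ *-cong (*-identityʳ _) (after-≈ F finite) ⟩
      (1# + - P F v) * (finitePart (dist F v) + expectedCost F vs)  ≈⟨ distribˡ _ _ _ ⟩
      (1# + - P F v) * finitePart (dist F v) + (1# + - P F v) * expectedCost F vs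
        ≤⟨ +-monoˡ-≤ _ (stayCost-≤ F v) ⟩
      (P F v + P F v) + (1# + - P F v) * expectedCost F vs        ≈⟨ +-comm _ _ ⟩
      (1# + - P F v) * expectedCost F vs + (P F v + P F v)        ∎

  ∣∷∣-≤ : ∀ v F → ∣ v ∷ F ∣ ≤ 1# + ∣ F ∣
  ∣∷∣-≤ v F = +-monoʳ-≤ 1# (fromℕ-mono-≤ (length-filter _ (deduplicate _≟ₘ_ F)))

  -- The factor three arises here: each round adds at most `P F v` for the facility and
  -- `P F v + P F v` for the assignment. Under `partition` every demand has total weight `1#` over
  -- the selections, so their openings add up to all openings.
  expectedCost-≤-openings : ∀ (xs : List A) (χ : A → Point → Bool) → (∀ v → ∑ xs (λ x → indicator (χ x v)) ≈ 1#) →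
    ∀ F (vs : Vec Point n) → expectedCost F vs ≤ ∣ F ∣ + fromℕ 3 * ∑ xs (λ x → openings (χ x) F vs)
  expectedCost-≤-openings xs χ partition F [] = ≤-reflexive (trans (expect-pure (fin ∣ F ∣) finitePart)
    (sym (trans (+-congˡ (trans (*-congˡ (∑-zero xs)) (zeroʳ _))) (+-identityʳ _))))
  expectedCost-≤-openings xs χ partition F (v ∷ vs) = begin
    expectedCost F (v ∷ vs)
      ≤⟨ expectedCost-∷-≤ F v vs ⟩
    q * expectedCost (v ∷ F) vs + ((1# + - q) * expectedCost F vs + (q + q))
      ≤⟨ +-mono-≤
           (*-monoˡ-≤ (0≤P F v) (≤-trans (expectedCost-≤-openings xs χ partition (v ∷ F) vs) (+-monoˡ-≤ _ (∣∷∣-≤ v F))))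
           (+-monoˡ-≤ _ (*-monoˡ-≤ (0≤y-x (P≤1 F v)) (expectedCost-≤-openings xs χ partition F vs))) ⟩
    q * (1# + ∣ F ∣ + fromℕ 3 * total′ (v ∷ F)) + ((1# + - q) * (∣ F ∣ + fromℕ 3 * total′ F) + (q + q))
      -- `three` is `fromℕ 3` unfolded, so that the solved equation matches the goal by definition.
      ≈⟨ solve 4 (λ q f x y → let three = con (+ 1) :+ (con (+ 1) :+ (con (+ 1) :+ con (+ 0))) in
             q :* (con (+ 1) :+ f :+ three :* x) :+ ((con (+ 1) :- q) :* (f :+ three :* y) :+ (q :+ q))
             := f :+ three :* (q :* (con (+ 1) :+ x) :+ (con (+ 1) :- q) :* y))
           refl q ∣ F ∣ (total′ (v ∷ F)) (total′ F) ⟩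
    ∣ F ∣ + fromℕ 3 * (q * (1# + total′ (v ∷ F)) + (1# + - q) * total′ F)
      ≈⟨ +-congˡ (*-congˡ total-∷) ⟨
    ∣ F ∣ + fromℕ 3 * ∑ xs (λ x → openings (χ x) F (v ∷ vs))
      ∎
    where
    q = P F v

    total′ : Facilities → Carrier
    total′ F′ = ∑ xs (λ x → openings (χ x) F′ vs)

    total-∷ : ∑ xs (λ x → openings (χ x) F (v ∷ vs)) ≈ q * (1# + total′ (v ∷ F)) + (1# + - q) * total′ F
    total-∷ = trans (∑-+ xs _ _)
      (+-cong (trans (∑-*ˡ xs q _) (*-congˡ (trans (∑-+ xs _ _) (+-congʳ (partition v)))))
              (∑-*ˡ xs (1# + - q) _))

-- Clusters of a solution and the competitive ratio

module Competitiveness {c ℓ₁ ℓ₂ a ℓ} (R : OrderedField c ℓ₁ ℓ₂) (M : MetricSpace R a ℓ) where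
  open OrderedField R
  open FacilityLocation R M
  open OrderedFieldProperties R
  open ListSum R
  open Expectation R
  open OpeningProbability R M
  open Openings R M
  open CostOfRun R M
  open IsGeneralMetric isMetric using (cong; module EqC)
  open ℤ-Solver using (solve; _:=_; _:*_)
  open ≤-Reasoning

  dist-attained : ∀ u F v → Any (λ x → d x v ≤ finitePart (dist (u ∷ F) v)) (u ∷ F)
  dist-attained u []      v = here ≤-refl
  dist-attained u (x ∷ F) v with dist (x ∷ F) v | dist-attained x F v | finite-dist x F v
  ... | _ | nearest | y , ≡.refl with ⊓-sel (d u v) y
  ...   | inj₁ ⊓≈d = here (≤-reflexive (sym ⊓≈d))
  ...   | inj₂ ⊓≈y = there (Any.map (λ d≤y → ≤-trans d≤y (≤-reflexive (sym ⊓≈y))) nearest)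

  module Clustering (u : Point) (F : Facilities) where
    -- Coincident facilities must not form separate clusters: each cluster is charged one unit, and
    -- only the deduplicated list has exactly `∣ u ∷ F ∣` units to pay.
    centres : Facilities
    centres = deduplicate _≟ₘ_ (u ∷ F)

    nearest : ∀ v → Any (λ x → d x v ≤ finitePart (dist (u ∷ F) v)) centres
    nearest v = Any.deduplicate⁺ _≟ₘ_
      (λ x≈y → ≤-trans (≤-reflexive (cong x≈y EqC.refl))) (dist-attained u F v)

    nearestIndex : Point → Fin (length centres)
    nearestIndex v = Any.index (nearest v)

    inCluster : Fin (length centres) → Point → Bool
    inCluster j v = does (nearestIndex v Fin.≟ j)

    indices : List (Fin (length centres))
    indices = allFin (length centres)

    open module C (j : Fin (length centres)) = Cluster (List.lookup centres j) (inCluster j)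
      using (credit; remainingCredit; ∑-openings-≤-credit)

    ∑-inCluster : ∀ v → ∑ indices (λ j → indicator (inCluster j v)) ≈ 1#
    ∑-inCluster v = trans (∑-cong indices (λ j → sym (*-identityʳ _))) (∑-δ (nearestIndex v) (λ _ → 1#))

    -- Only the cluster of `v` contributes, and twice the halved distance to its centre is the
    -- distance to a nearest facility.
    ∑-credit-≤ : ∀ v → ∑ indices (λ j → credit j v) ≤ finitePart (dist (u ∷ F) v)
    ∑-credit-≤ v = begin
      ∑ indices (λ j → credit j v)                  ≈⟨ ∑-δ (nearestIndex v) (λ j → half (List.lookup centres j) v + half (List.lookup centres j) v) ⟩
      half x v + half x v                           ≈⟨ ½x+½x≈x (d x v) ⟩
      d x v                                         ≤⟨ Any.lookup-index (nearest v) ⟩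
      finitePart (dist (u ∷ F) v)                   ∎
      where x = List.lookup centres (nearestIndex v)

    optimum : Vec Point n → Carrier
    optimum U = ∣ u ∷ F ∣ + ∑ (toList U) (λ v → finitePart (dist (u ∷ F) v))

    cost-≐ : ∀ (U : Vec Point n) → cost U (u ∷ F) ≐ optimum U
    cost-≐ U = +⁺-≐ (_ , ≡.refl , refl) (assignment U)
      where
      finite-≐ : ∀ {x} → Finite x → x ≐ finitePart x
      finite-≐ (_ , ≡.refl) = _ , ≡.refl , refl

      assignment : ∀ {n} (U : Vec Point n) → Vec.foldr′ (λ v s → dist (u ∷ F) v +⁺ s) (fin 0#) U
                 ≐ ∑ (toList U) (λ v → finitePart (dist (u ∷ F) v))
      assignment []      = _ , ≡.refl , refl
      assignment (v ∷ U) = +⁺-≐ (finite-≐ (finite-dist u F v)) (assignment U)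

    -- Interchanging the sums lets each cluster be bounded on its own. The credits then add up to at
    -- most the assignment cost, and the units `1#` to the number of centres.
    ∑-openings-≤-optimum : ∀ (U : Vec Point n) →
      ∑ (permutations U) (λ vs → ∑ indices (λ j → openings (inCluster j) [] vs)) ≤ fromℕ (n !) * optimum U
    ∑-openings-≤-optimum {n = n} U = begin
      ∑ (permutations U) (λ vs → ∑ indices (λ j → openings (inCluster j) [] vs))
        ≈⟨ ∑-comm (permutations U) indices _ ⟩
      ∑ indices (λ j → ∑ (permutations U) (openings (inCluster j) []))
        ≤⟨ ∑-mono-≤ indices (λ j → ∑-openings-≤-credit j [] U) ⟩
      ∑ indices (λ j → fromℕ (n !) * (remainingCredit j U + 1#))
        ≈⟨ ∑-*ˡ indices (fromℕ (n !)) _ ⟩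
      fromℕ (n !) * ∑ indices (λ j → remainingCredit j U + 1#)
        ≤⟨ *-monoˡ-≤ (0≤fromℕ (n !)) total-≤ ⟩
      fromℕ (n !) * optimum U
        ∎
      where
      total-≤ : ∑ indices (λ j → remainingCredit j U + 1#) ≤ optimum U
      total-≤ = begin
        ∑ indices (λ j → remainingCredit j U + 1#)
          ≈⟨ ∑-+ indices (λ j → remainingCredit j U) (λ _ → 1#) ⟩
        ∑ indices (λ j → remainingCredit j U) + ∑ indices (λ _ → 1#)
          ≈⟨ +-cong (∑-comm indices (toList U) credit) (trans (∑-allFin-const (length centres) 1#) (*-identityʳ _)) ⟩
        ∑ (toList U) (λ v → ∑ indices (λ j → credit j v)) + ∣ u ∷ F ∣
          ≤⟨ +-monoˡ-≤ _ (∑-mono-≤ (toList U) ∑-credit-≤) ⟩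
        ∑ (toList U) (λ v → finitePart (dist (u ∷ F) v)) + ∣ u ∷ F ∣
          ≈⟨ +-comm _ _ ⟩
        optimum U
          ∎

    ∑-expectedCost-≤ : ∀ (U : Vec Point n) →
      ∑ (permutations U) (expectedCost []) ≤ fromℕ (length (permutations U)) * (fromℕ 3 * optimum U)
    ∑-expectedCost-≤ {n = n} U = begin
      ∑ (permutations U) (expectedCost [])
        ≤⟨ ∑-mono-≤ (permutations U) (λ vs → ≤-respʳ-≈ (+-identityˡ _)
             (expectedCost-≤-openings indices inCluster ∑-inCluster [] vs)) ⟩
      ∑ (permutations U) (λ vs → fromℕ 3 * ∑ indices (λ j → openings (inCluster j) [] vs))
        ≈⟨ ∑-*ˡ (permutations U) (fromℕ 3) _ ⟩
      fromℕ 3 * ∑ (permutations U) (λ vs → ∑ indices (λ j → openings (inCluster j) [] vs))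
        ≤⟨ *-monoˡ-≤ (0≤fromℕ 3) (∑-openings-≤-optimum U) ⟩
      fromℕ 3 * (fromℕ (n !) * optimum U)
        ≈⟨ solve 3 (λ t f x → t :* (f :* x) := f :* (t :* x)) refl (fromℕ 3) (fromℕ (n !)) (optimum U) ⟩
      fromℕ (n !) * (fromℕ 3 * optimum U)
        -- Evaluating one constant sum in two ways trades `n !` for the length of `permutations U`,
        -- the normalisation used by `uniform`.
        ≈⟨ ∑-permutations-const U _ ⟨
      ∑ (permutations U) (λ _ → fromℕ 3 * optimum U)
        ≈⟨ ∑-const (permutations U) _ ⟩
      fromℕ (length (permutations U)) * (fromℕ 3 * optimum U)
        ∎

  permutations≉0 : ∀ (U : Vec Point n) → ¬ (fromℕ (length (permutations U)) ≈ 0#)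
  permutations≉0 {n = n} U len≈0 = fromℕ≉0 (n !) {{n ℕ.!≢0}} (begin-equality
    fromℕ (n !)                             ≈⟨ *-identityʳ _ ⟨
    fromℕ (n !) * 1#                        ≈⟨ ∑-permutations-const U 1# ⟨
    ∑ (permutations U) (λ _ → 1#)           ≈⟨ ∑-const (permutations U) 1# ⟩
    fromℕ (length (permutations U)) * 1#    ≈⟨ *-identityʳ _ ⟩
    fromℕ (length (permutations U))         ≈⟨ len≈0 ⟩
    0#                                      ∎)
    where
    fromℕ≉0 : ∀ k .{{_ : ℕ.NonZero k}} → ¬ (fromℕ k ≈ 0#)
    fromℕ≉0 (suc k) = fromℕ[1+n]≉0 k

  ALG-almostFinite : ∀ (U : Vec Point n) → AlmostFinite (ALG U)
  ALG-almostFinite U = AlmostFinite->>= {f = run ½DistProb []}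
    (All.universal (λ (p , vs) → inj₂ (run-almostFinite [] vs)) (uniform (permutations U)))

  expect-uniform : ∀ (xs : List A) f → expect (uniform xs) f ≈ fromℕ (length xs) ⁻¹ * ∑ xs f
  expect-uniform xs f = trans (reflexive (∑-map _ xs _)) (∑-*ˡ xs _ f)

  E-ALG-≐ : ∀ (U : Vec Point n) →
    E (ALG U) ≐ fromℕ (length (permutations U)) ⁻¹ * ∑ (permutations U) (expectedCost [])
  E-ALG-≐ U = ≐-resp-≈ (E-≐ (ALG-almostFinite U))
    (trans (expect->>= (uniform (permutations U)) (run ½DistProb []) finitePart)
      (expect-uniform (permutations U) (expectedCost [])))

  ·-mono-≐ : ∀ {x y u v p} → x ≐ u → y ≐ v → u ≤ p * v → x ≤⁺ p · y
  ·-mono-≐ (_ , ≡.refl , x≈u) (_ , ≡.refl , y≈v) u≤pv =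
    [ ≤-respˡ-≈ (sym x≈u) (≤-respʳ-≈ (*-congˡ (sym y≈v)) u≤pv) ]

  ≤-3·∞ : ∀ x → x ≤⁺ fromℕ 3 · ∞
  ≤-3·∞ x with fromℕ 3 ≟ 0#
  ... | yes 3≈0 = contradiction 3≈0 (fromℕ[1+n]≉0 2)
  ... | no  _   = x ≤⊤⁺

  -- The empty solution has infinite cost because at least one demand is present, and tripling keeps
  -- it infinite. A nonempty solution supplies the centres for the clustering.
  3-competitive : ∀ (U : Vec Point (suc n)) F → E (ALG U) ≤⁺ fromℕ 3 · cost U F
  3-competitive (v ∷ U) []      = ≤-3·∞ (E (ALG (v ∷ U)))
  3-competitive U       (u ∷ F) = ·-mono-≐ (E-ALG-≐ U) (cost-≐ U) (begin
    Λ ⁻¹ * ∑ (permutations U) (expectedCost [])    ≤⟨ *-monoˡ-≤ (⁻¹-nonNegative (0≤fromℕ (length (permutations U))) Λ≉0) (∑-expectedCost-≤ U) ⟩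
    Λ ⁻¹ * (Λ * (fromℕ 3 * optimum U))             ≈⟨ solve 3 (λ i l x → i :* (l :* x) := l :* i :* x) refl (Λ ⁻¹) Λ _ ⟩
    Λ * Λ ⁻¹ * (fromℕ 3 * optimum U)               ≈⟨ trans (*-congʳ (⁻¹-inverseʳ Λ≉0)) (*-identityˡ _) ⟩
    fromℕ 3 * optimum U                            ∎)
    where
    open Clustering u F
    Λ = fromℕ (length (permutations U))
    Λ≉0 = permutations≉0 U

corollary4p9 : ∀ {c ℓ₁ ℓ₂ a ℓ : Level} (R : OrderedField c ℓ₁ ℓ₂) (M : MetricSpace R a ℓ) →
    let open OrderedField R
        open FacilityLocation R M in
    ∀ {n : ℕ} (U : Vec Point (suc n)) (F* : Facilities) → IsOptimal U F* →
    E (ALG U) ≤⁺ fromℕ 3 · cost U F*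
corollary4p9 R M U F* _ = Competitiveness.3-competitive R M U F*
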